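{- Let $a, d_1,\dots,d_k$ be positive integers such that the generalized Douglas region $D_a(d_1,\dots,d_k)$ (defined in the context) has width $w$ and has its western and eastern vertices $D$ and $B$ on the same horizontal line. Then the number of tilings of $D_a(d_1,\dots,d_k)$ is $$\operatorname{M}(D_a(d_1,\dots,d_k)) = 2^{\mathcal{C}-w(w+1)/2},$$ where $\mathcal{C}$ is the number of regular cells of the region.
   Context: Work in the square lattice in which some southwest-to-northeast lattice diagonals are "drawn in"; each unit square crossed by a drawn-in diagonal is cut into two triangles. The resulting pieces (uncut unit squares and triangles) are the fundamental regions. A tile is a union of two fundamental regions sharing an edge, a tiling of a region is a covering by tiles without gaps or overlaps, and $\operatorname{M}(R)$ is the number of tilings of $R$. Distances between diagonals are measured in units of $\sqrt2/2$, the distance between consecutive lattice diagonals. Construction of $D_a(d_1,\dots,d_k)$: fix two southwest-to-northeast lattice diagonals $\ell$ (upper) and $\ell'$ (lower), neither drawn in, and draw in $k-1$ diagonals strictly between them so that the distance from $\ell$ to the top drawn-in diagonal is $d_1$, the distances between successive drawn-in diagonals (from the top) are $d_2,\dots,d_{k-1}$, and the distance from the bottom drawn-in diagonal to $\ell'$ is $d_k$. Color the fundamental regions black and white so that regions sharing an edge have opposite colors and the unit squares passed through by $\ell$ are white. Let $A$ be a lattice point on $\ell$; starting from $A$, take unit steps south or east such that at each step the fundamental region on the left of the step is black, until reaching $\ell'$ at a lattice point $B$; this path is the northeastern boundary. Let $D$ be the lattice point on $\ell$ at distance $a\sqrt2$ southwest of $A$. The southwestern boundary is the reflection of the northeastern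 boundary in the perpendicular bisector of $AD$ (with step directions reversed), running from $C$ to $D$, where $C$ (on $\ell'$) is the reflection of $B$. Join $D$ to $A$ by a zigzag path of alternating east and north unit steps with the squares passed through by $\ell$ on its right, and join $B$ to $C$ by a similar zigzag path with the squares passed through by $\ell'$ on its right. The region bounded by these four paths is $D_a(d_1,\dots,d_k)$. It is assumed that $\ell'$ passes through white unit squares and that the northeastern and southwestern boundaries do not intersect. The fundamental regions inside the region are cells. Triangular cells point towards $\ell'$ ("down-pointing") or away from $\ell'$ ("up-pointing"). A cell is regular if it is a black square or a black up-pointing triangle. The width of the region is $|BC|/\sqrt2$, which equals the number of white squares in the bottom row of square cells (the row of square cells passed through by the lowest lattice diagonal meeting the region in squares).
   Formalization: On the northeastern boundary the black fundamental region is taken on the interior side of each step (west of a south step, south of an east step); with black on the walker's left the region always has more white than black cells and has no tilings. -}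

module Defs where

open import Data.Nat as ℕ using (ℕ; zero; suc; _+_; _*_; _≤_; _<ᵇ_; _≡ᵇ_)
open import Data.Nat.DivMod using (_/_; _%_)
open import Data.Nat.ListAction using (sum)
open import Data.Bool.ListAction using (all; any)
open import Data.Integer as ℤ using (ℤ; +_; _-_; ∣_∣)
open import Data.Bool using (Bool; true; false; if_then_else_; _∧_; not; T)
open import Data.List using (List; []; _∷_; length; lookup; upTo; allFin; concatMap; filterᵇ; map)
open import Data.Vec as V using (Vec)
open import Data.Maybe using (Maybe; just; nothing)
open import Data.Product using (_×_; _,_; proj₁; proj₂; Σ)
open import Relation.Nullary.Decidable using (⌊_⌋)

-- Conventions.
-- Lattice coordinates: the point A is the origin (0,0); ℓ is the
-- diagonal x - y = 0 and the diagonal x - y = c is at distance c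
-- (in units of √2/2) below ℓ.  ℓ' is x - y = N with N = d₁+…+d_k.
-- Every unit square is named by (row , col): its south-west corner is
-- (col , col - row); 'row' is the index of the SW–NE diagonal through it.
-- A square whose diagonal is drawn in is cut into the up-pointing
-- (north-west) triangle 'up' and the down-pointing (south-east) 'down'.

data Piece : Set where
  sq up down : Piece

pieceEq : Piece → Piece → Bool
pieceEq sq sq = true
pieceEq up up = true
pieceEq down down = true
pieceEq _ _ = false

record Cell : Set where
  constructor cell
  field
    row   : ℕ
    col   : ℤ
    piece : Piece

cellEq : Cell → Cell → Bool
cellEq (cell r x p) (cell r' x' p') = (r ≡ᵇ r') ∧ ⌊ x ℤ.≟ x' ⌋ ∧ pieceEq p p'

data Dir : Set where
  dE dW dN dS dG : Dir   -- east, west, north, south, the drawn diagonal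

dirEq : Dir → Dir → Bool
dirEq dE dE = true
dirEq dW dW = true
dirEq dN dN = true
dirEq dS dS = true
dirEq dG dG = true
dirEq _ _ = false

opp : Dir → Dir
opp dE = dW
opp dW = dE
opp dN = dS
opp dS = dN
opp dG = dG

data Color : Set where
  white black : Color

Point : Set
Point = ℤ × ℤ

-- reflection in the line x + y = -a, i.e. the perpendicular bisector of
-- AD where A = (0,0), D = (-a,-a)
reflect : ℕ → Point → Point
reflect a (x , y) = (ℤ.- (+ a) - y , ℤ.- (+ a) - x)

-- positions (distances from ℓ) of the drawn-in diagonals:
-- d₁, d₁+d₂, …, d₁+…+d_{k-1}
drawnFrom : ℕ → List ℕ → List ℕ
drawnFrom acc []            = []
drawnFrom acc (d ∷ [])      = []
drawnFrom acc (d ∷ e ∷ ds)  = (acc + d) ∷ drawnFrom (acc + d) (e ∷ ds)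

module Region (a : ℕ) (ds : List ℕ) where

  drawn : List ℕ
  drawn = drawnFrom 0 ds

  N : ℕ
  N = sum ds

  isCut : ℕ → Bool
  isCut r = any (λ t → t ≡ᵇ r) drawn

  cntAbove : ℕ → ℕ
  cntAbove r = length (filterᵇ (λ t → t <ᵇ r) drawn)

  -- regions are coloured by their "level" counted from ℓ:
  -- pieces sharing an edge have consecutive levels; level 0 (squares
  -- crossed by ℓ) is white
  level : Cell → ℕ
  level (cell r x p) = r + cntAbove r + (if pieceEq p down then 1 else 0)

  color : Cell → Color
  color c = if (level c % 2) ≡ᵇ 0 then white else black

  isBlack : Cell → Bool
  isBlack c with color c
  ... | black = true
  ... | white = false

  westPiece northPiece eastPiece southPiece : ℕ → Piece
  westPiece  r = if isCut r then up   else sq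
  northPiece r = if isCut r then up   else sq
  eastPiece  r = if isCut r then down else sq
  southPiece r = if isCut r then down else sq

  -- northeastern boundary: P d is its lattice point on the diagonal at
  -- distance d from ℓ.  Reading: the step is chosen so
  -- that the black fundamental region is on the left *as seen in the
  -- picture*, i.e. on the interior (west/south) side of the step.  From
  -- (x,y) (on diagonal d) a south step has on its west the region of
  -- square (x-1 , y-1) (row d) adjacent to its east edge; an east step
  -- has on its south the region of square (x , y-1) (row d+1) adjacent
  -- to its north edge.  Exactly one of these two regions is black; we
  -- step south iff the first one is black.
  P : ℕ → Point
  P zero = (+ 0 , + 0)
  P (suc d) with P d
  ... | (x , y) =
    if isBlack (cell d (x - + 1) (eastPiece d))
    then (x , y - + 1)
    else (x ℤ.+ + 1 , y)

  Q : ℕ → Point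
  Q d = reflect a (P d)

  A B C D : Point
  A = P 0
  B = P N
  C = Q N
  D = reflect a A

  -- width |BC| / √2  (B and C lie on the same diagonal ℓ')
  width : ℕ
  width = ∣ proj₁ B - proj₁ C ∣

  -- the squares of row r in the region: south-west corner from x(Q r)
  -- to x(P r) - 1
  rowLen : ℕ → ℕ
  rowLen r = if ⌊ proj₁ (Q r) ℤ.≤? proj₁ (P r) ⌋ then ∣ proj₁ (P r) - proj₁ (Q r) ∣ else 0

  piecesOf : ℕ → ℤ → List Cell
  piecesOf r x = if isCut r then cell r x up ∷ cell r x down ∷ [] else cell r x sq ∷ []

  cells : List Cell
  cells = concatMap (λ r → concatMap (λ i → piecesOf r (proj₁ (Q r) ℤ.+ + i)) (upTo (rowLen r)))
                    (upTo (suc N))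

  -- the fundamental region across the edge of the given direction
  -- (nothing if the region has no such edge, or it is above ℓ)
  neighbor : Cell → Dir → Maybe Cell
  neighbor (cell r x sq)   dE = just (cell (suc r) (x ℤ.+ + 1) (westPiece (suc r)))
  neighbor (cell r x down) dE = just (cell (suc r) (x ℤ.+ + 1) (westPiece (suc r)))
  neighbor (cell r x sq)   dS = just (cell (suc r) x (northPiece (suc r)))
  neighbor (cell r x down) dS = just (cell (suc r) x (northPiece (suc r)))
  neighbor (cell (suc r) x sq) dW = just (cell r (x - + 1) (eastPiece r))
  neighbor (cell (suc r) x up) dW = just (cell r (x - + 1) (eastPiece r))
  neighbor (cell (suc r) x sq) dN = just (cell r x (southPiece r))
  neighbor (cell (suc r) x up) dN = just (cell r x (southPiece r))
  neighbor (cell r x up)   dG = just (cell r x down)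
  neighbor (cell r x down) dG = just (cell r x up)
  neighbor _ _ = nothing

  nCells : ℕ
  nCells = length cells

  -- A tiling is recorded by giving, for each cell, the direction of the
  -- edge it shares with the other cell of its tile.  Valid iff the cell
  -- across that edge is a cell of the region whose recorded direction
  -- points back.
  isTiling : Vec Dir nCells → Bool
  isTiling v = all ok (allFin nCells)
    where
    ok : _ → Bool
    ok i with neighbor (lookup cells i) (V.lookup v i)
    ... | nothing = false
    ... | just c' = any (λ j → cellEq (lookup cells j) c' ∧ dirEq (V.lookup v j) (opp (V.lookup v i)))
                        (allFin nCells)

  Tiling : Set
  Tiling = Σ (Vec Dir nCells) (λ v → T (isTiling v))

  isRegular : Cell → Bool
  isRegular c = isBlack c ∧ not (pieceEq (Cell.piece c) down)

  nRegular : ℕ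
  nRegular = length (filterᵇ isRegular cells)

triangular : ℕ → ℕ
triangular w = (w * suc w) / 2

{-# OPTIONS --safe #-}
module Submission where

-- Cut the region into its diagonal rows.  The cells facing each other across
-- two consecutive rows form a path, with black ends, and a tiling amounts to
-- a matching of each of these paths such that every square, respectively
-- every pair of triangles glued along a drawn-in diagonal, is used
-- consistently.  Going down, the rows grow or shrink by one, which gives a
-- word in two letters ex and co with a letters co and w letters ex.  After
-- complementing the states in the rows before a letter ex, the transfer
-- matrices depend on the letter only and satisfy ex co = 2 co ex.  Sorting the
-- word into co … co ex … ex, which has a single chain of states, shows that the
-- number of tilings is 2 to the number of inversions, and counting the regular
-- cells row by row gives w (w + 1) / 2 plus the same number.

open import Defs
open import Axiom.UniquenessOfIdentityProofs using (module Decidable⇒UIP)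
open import Data.Bool using (Bool; true; false; not; T; if_then_else_) renaming (_≟_ to _≟ᵇ_)
open import Data.Bool.ListAction using (all; any)
open import Data.Bool.Properties using (not-involutive; ∧-identityʳ; ∧-zeroʳ; T-∧; T-irrelevant)
open import Data.Empty using (⊥; ⊥-elim)
open import Data.Fin using (Fin; zero; suc)
open import Data.Fin.Properties using (*↔×; 2↔Bool)
open import Data.Integer as ℤ using (ℤ; +_; _-_; ∣_∣)
import Data.Integer.Properties as ℤ
open import Algebra.Properties.AbelianGroup ℤ.+-0-abelianGroup using (∙-cancelˡ)
open import Data.List using
  (List; []; _∷_; _++_; length; lookup; map; replicate; null; filterᵇ; concatMap; applyUpTo; upTo;
   allFin)
open import Data.List.Membership.Propositional using (_∈_; find; lose)
open import Data.List.Membership.Propositional.Properties using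
  (∈-concatMap⁻; ∈-concatMap⁺; ∈-lookup; ∈-allFin; ∈-upTo⁺; ∈-upTo⁻)
open import Data.List.Properties using (≡-dec; length-map; length-replicate)
open import Data.List.Relation.Unary.All as All using (All; []; _∷_)
import Data.List.Relation.Unary.All.Properties as All
open import Data.List.Relation.Unary.AllPairs using (AllPairs; []; _∷_)
import Data.List.Relation.Unary.AllPairs.Properties as AllPairs
open import Data.List.Relation.Unary.Any as Any using (Any; here; there)
import Data.List.Relation.Unary.Any.Properties as Any
open import Data.List.Relation.Unary.Unique.Propositional using (Unique)
import Data.List.Relation.Unary.Unique.Propositional.Properties as Unique
open import Data.Maybe using (just; nothing)
open import Data.Nat using (ℕ; zero; suc; _+_; _*_; _∸_; _^_; _≤_; _<_; _<ᵇ_; _≡ᵇ_; z≤n; s≤s)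
open import Data.Nat.DivMod using (_/_; _%_; m*n/n≡m)
open import Data.Nat.ListAction using (sum)
open import Data.Nat.Properties using
  (*-distribʳ-+; *-identityʳ; *-zeroʳ; +-assoc; +-comm; +-identityʳ; +-suc; +-∸-assoc; <-cmp;
   <-irrefl; <-trans; <ᵇ⇒<; <⇒<ᵇ; <⇒≢; <⇒≤; >⇒≢; ^-distribˡ-+-*; m+n∸m≡n; m<m+n; m≤m+n; m≤n+m;
   m≤n⇒m<n∨m≡n; m≤n⇒m≤1+n; n<1+n; n∸n≡0; suc-injective; ≡ᵇ⇒≡; ≡⇒≡ᵇ; ≤-refl; ≤-trans; ≤⇒≯)
open import Data.Nat.Tactic.RingSolver using (solve-∀)
open import Data.Product using (_×_; _,_; proj₁; proj₂; Σ)
open import Data.Product.Function.Dependent.Propositional using (Σ-↔)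
open import Data.Product.Function.NonDependent.Propositional using (_×-↔_)
open import Data.Sum using (_⊎_; inj₁; inj₂)
open import Data.Sum.Function.Propositional using (_⊎-↔_)
open import Data.Unit using (tt)
open import Data.Vec as V using (Vec; []; _∷_)
open import Data.Vec.Properties using (lookup∘tabulate; tabulate∘lookup; tabulate-cong)
open import Function.Bundles using (_↔_; mk↔ₛ′; Equivalence)
open import Function.Properties.Inverse using (↔-refl; ↔-sym; ↔-trans)
open import Relation.Binary.Definitions using (tri<; tri≈; tri>)
open import Relation.Binary.PropositionalEquality using
  (_≡_; _≢_; refl; sym; trans; cong; cong₂; subst; subst₂)
open import Relation.Nullary using (¬_; contradiction)
open import Relation.Nullary.Decidable using (yes; no; toWitness; fromWitness)

-- A square is matched on exactly one of its two sides and flips the letter, whereas the two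
-- triangles of a cut square are both matched outwards or to each other and keep it. So the sign
-- changes exactly when the covering is complemented, and a row has one and the same state seen from
-- the path above and from the path below. Nothing is matched across the boundary, and ℓ and ℓ' run
-- through white squares; this fixes the end states, all `false` at the top and all `true` at the
-- bottom. Equal height of D and B says that there are as many letters `co` as squares in the top
-- row: once the word is sorted, the contractions use up the row, and on the empty row all `false`
-- and all `true` agree. The relation between `ex` and `co` is not local, since a choice in the
-- middle row propagates along both paths. It is therefore proved for automata that carry, for each
-- path, whether the current black vertex is matched backwards. All counts are bijections, so the
-- factor 2 appears as a `Bool`.

-- Path matchings and the exchange relation between expansion and contraction

-- W and B record which of the vertices w₀ … wₙ₋₁ and b₀ … bₙ of the path
-- b₀ w₀ b₁ w₁ … wₙ₋₁ bₙ are covered by a matching; a matching is determined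
-- by the vertices it covers.  The carry says that b₀ is matched to the left.
Interlace : Bool → List Bool → List Bool → Set
Interlace c W [] = ⊥
Interlace c [] (b ∷ B) = c ≡ b × T (null B)
Interlace false (w ∷ W) (false ∷ B) = Interlace w W B
Interlace false (true ∷ W) (true ∷ B) = Interlace false W B
Interlace false (false ∷ W) (true ∷ B) = ⊥
Interlace true (w ∷ W) (true ∷ B) = Interlace w W B
Interlace true (w ∷ W) (false ∷ B) = ⊥

Interlace-length : ∀ c W B → Interlace c W B → length B ≡ suc (length W)
Interlace-length c [] (b ∷ []) z = refl
Interlace-length false (w ∷ W) (false ∷ B) z = cong suc (Interlace-length w W B z)
Interlace-length false (true ∷ W) (true ∷ B) z = cong suc (Interlace-length false W B z)
Interlace-length true (w ∷ W) (true ∷ B) z = cong suc (Interlace-length w W B z)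

Interlace-irrelevant : ∀ c W B (p q : Interlace c W B) → p ≡ q
Interlace-irrelevant c [] (b ∷ []) (refl , tt) (refl , tt) = refl
Interlace-irrelevant false (w ∷ W) (false ∷ B) p q = Interlace-irrelevant w W B p q
Interlace-irrelevant false (true ∷ W) (true ∷ B) p q = Interlace-irrelevant false W B p q
Interlace-irrelevant true (w ∷ W) (true ∷ B) p q = Interlace-irrelevant w W B p q

-- The longer row supplies the black vertices: `M` in `Expand`, `S` in `Contract`. Both rows are
-- complemented in `Expand`, because states are complemented coverings around a letter `ex`.
Expand Contract : List Bool → List Bool → Set
Expand S M = Interlace false (map not S) (map not M)
Contract S M = Interlace false M S

-- Carry automata for the two products of Expand and Contract, read from left to right.
EC CE : Bool → Bool → List Bool → List Bool → Set
EC c d S U = Σ (List Bool) λ M → Interlace c (map not S) (map not M) × Interlace d U M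
CE c d S U = Σ (List Bool) λ M → Interlace c M S × Interlace d (map not M) (map not U)

EC-length : ∀ c d S U → EC c d S U → length S ≡ length U
EC-length c d S U (M , z , z′) = suc-injective (trans (cong suc (sym (length-map not S)))
  (trans (sym (Interlace-length _ (map not S) (map not M) z)) (trans (length-map not M) (Interlace-length _ U M z′))))

CE-length : ∀ c d S U → CE c d S U → length S ≡ length U
CE-length c d S U (M , z , z′) = trans (Interlace-length _ M S z) (trans (cong suc (sym (length-map not M)))
  (trans (sym (Interlace-length _ (map not M) (map not U) z′)) (length-map not U)))

⊥↔ : ∀ {A B : Set} → ¬ A → ¬ B → A ↔ B
⊥↔ na nb = mk↔ₛ′ (λ a → ⊥-elim (na a)) (λ b → ⊥-elim (nb b)) (λ b → ⊥-elim (nb b)) (λ a → ⊥-elim (na a))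

Bool×↔⊎ : ∀ {A : Set} → (Bool × A) ↔ (A ⊎ A)
Bool×↔⊎ = mk↔ₛ′ (λ { (true , a) → inj₁ a ; (false , a) → inj₂ a })
  (λ { (inj₁ a) → true , a ; (inj₂ a) → false , a })
  (λ { (inj₁ a) → refl ; (inj₂ a) → refl })
  (λ { (true , a) → refl ; (false , a) → refl })

EC-ft : ∀ s S u U → EC false true (s ∷ S) (u ∷ U) ↔ EC (not s) u S U
EC-ft s S u U = mk↔ₛ′ to from (λ _ → refl) inv
  where
  to : EC false true (s ∷ S) (u ∷ U) → EC (not s) u S U
  to (true ∷ M , z , z′) = M , z , z′
  from : EC (not s) u S U → EC false true (s ∷ S) (u ∷ U)
  from (M , z , z′) = true ∷ M , z , z′
  inv : ∀ x → from (to x) ≡ x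
  inv (true ∷ M , z , z′) = refl

EC-tf : ∀ s S u U → EC true false (s ∷ S) (u ∷ U) ↔ EC (not s) u S U
EC-tf s S u U = mk↔ₛ′ to from (λ _ → refl) inv
  where
  to : EC true false (s ∷ S) (u ∷ U) → EC (not s) u S U
  to (false ∷ M , z , z′) = M , z , z′
  from : EC (not s) u S U → EC true false (s ∷ S) (u ∷ U)
  from (M , z , z′) = false ∷ M , z , z′
  inv : ∀ x → from (to x) ≡ x
  inv (false ∷ M , z , z′) = refl

-- A carry on the first path forces the head of the middle row to be `false`, a carry on the second
-- forces it to be `true`.
¬EC-tt : ∀ S U → ¬ EC true true S U
¬EC-tt [] [] (true ∷ M , (() , _) , _)
¬EC-tt [] [] (false ∷ M , _ , (() , _))
¬EC-tt [] (u ∷ U) x with EC-length true true [] (u ∷ U) x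
... | ()
¬EC-tt (s ∷ S) [] x with EC-length true true (s ∷ S) [] x
... | ()
¬EC-tt (s ∷ S) (u ∷ U) (true ∷ M , () , _)
¬EC-tt (s ∷ S) (u ∷ U) (false ∷ M , _ , ())

-- A single carry forces the head of the middle row; the two cases force opposite values but then
-- leave the same carries, `not s` and `u`.
EC-ft↔tf : ∀ S U → EC false true S U ↔ EC true false S U
EC-ft↔tf [] [] = mk↔ₛ′ to from to∘from from∘to
  where
  to : EC false true [] [] → EC true false [] []
  to (true ∷ [] , z , z′) = false ∷ [] , (refl , tt) , (refl , tt)
  from : EC true false [] [] → EC false true [] []
  from (false ∷ [] , z , z′) = true ∷ [] , (refl , tt) , (refl , tt)
  to∘from : ∀ x → to (from x) ≡ x
  to∘from (false ∷ [] , (refl , tt) , (refl , tt)) = refl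
  from∘to : ∀ x → from (to x) ≡ x
  from∘to (true ∷ [] , (refl , tt) , (refl , tt)) = refl
EC-ft↔tf [] (u ∷ U) = ⊥↔ (λ x → contradiction (EC-length false true [] (u ∷ U) x) λ ()) (λ x → contradiction (EC-length true false [] (u ∷ U) x) λ ())
EC-ft↔tf (s ∷ S) [] = ⊥↔ (λ x → contradiction (EC-length false true (s ∷ S) [] x) λ ()) (λ x → contradiction (EC-length true false (s ∷ S) [] x) λ ())
EC-ft↔tf (s ∷ S) (u ∷ U) = ↔-trans (EC-ft s S u U) (↔-sym (EC-tf s S u U))

EC-ff-same : ∀ s S U → EC false false (s ∷ S) (s ∷ U) ↔ EC false false S U
EC-ff-same false S U = mk↔ₛ′ (λ { (false ∷ M , z , z′) → M , z , z′ }) (λ { (M , z , z′) → false ∷ M , z , z′ })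
  (λ _ → refl) (λ { (false ∷ M , z , z′) → refl })
EC-ff-same true S U = mk↔ₛ′ (λ { (true ∷ M , z , z′) → M , z , z′ }) (λ { (M , z , z′) → true ∷ M , z , z′ })
  (λ _ → refl) (λ { (true ∷ M , z , z′) → refl })

EC-ff-ft : ∀ S U → EC false false (false ∷ S) (true ∷ U) ↔ (EC true false S U ⊎ EC false true S U)
EC-ff-ft S U = mk↔ₛ′
  (λ { (true ∷ M , z , z′) → inj₁ (M , z , z′) ; (false ∷ M , z , z′) → inj₂ (M , z , z′) })
  (λ { (inj₁ (M , z , z′)) → true ∷ M , z , z′ ; (inj₂ (M , z , z′)) → false ∷ M , z , z′ })
  (λ { (inj₁ _) → refl ; (inj₂ _) → refl })
  (λ { (true ∷ M , z , z′) → refl ; (false ∷ M , z , z′) → refl })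

¬EC-ff-tf : ∀ S U → ¬ EC false false (true ∷ S) (false ∷ U)
¬EC-ff-tf S U (true ∷ M , _ , ())
¬EC-ff-tf S U (false ∷ M , () , _)

CE-ff-same : ∀ s S U → CE false false (s ∷ S) (s ∷ U) ↔ CE false false S U
CE-ff-same false S U = mk↔ₛ′ to from (λ _ → refl) inv
  where
  to : CE false false (false ∷ S) (false ∷ U) → CE false false S U
  to ([] , z , (() , _))
  to (false ∷ M , z , z′) = M , z , z′
  from : CE false false S U → CE false false (false ∷ S) (false ∷ U)
  from (M , z , z′) = false ∷ M , z , z′
  inv : ∀ x → from (to x) ≡ x
  inv ([] , z , (() , _))
  inv (false ∷ M , z , z′) = refl
CE-ff-same true S U = mk↔ₛ′ to from (λ _ → refl) inv
  where
  to : CE false false (true ∷ S) (true ∷ U) → CE false false S U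
  to ([] , (() , _) , z′)
  to (true ∷ M , z , z′) = M , z , z′
  from : CE false false S U → CE false false (true ∷ S) (true ∷ U)
  from (M , z , z′) = true ∷ M , z , z′
  inv : ∀ x → from (to x) ≡ x
  inv ([] , (() , _) , z′)
  inv (true ∷ M , z , z′) = refl

¬CE[] : ∀ c d U → ¬ CE c d [] U
¬CE[] c d U (M , () , _)

-- The heads are uncovered on both paths (that of the second row after complementing), so they do
-- not constrain the first entry of the middle row.
Free : List Bool → List Bool → Set
Free S U = CE false false (false ∷ S) (true ∷ U)

-- A head already matched to the left affects the rest of its path exactly as an uncovered head
-- without carry does, so the carry can be traded for the entry.
CE-ft-ff : ∀ S U → CE false true (false ∷ S) (false ∷ U) ↔ Free S U
CE-ft-ff S U = mk↔ₛ′ to from to∘from from∘to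
  where
  to : CE false true (false ∷ S) (false ∷ U) → Free S U
  to ([] , z , (_ , n)) = [] , z , (refl , n)
  to (true ∷ M , z) = true ∷ M , z
  to (false ∷ M , z) = false ∷ M , z
  from : Free S U → CE false true (false ∷ S) (false ∷ U)
  from ([] , z , (_ , n)) = [] , z , (refl , n)
  from (true ∷ M , z) = true ∷ M , z
  from (false ∷ M , z) = false ∷ M , z
  to∘from : ∀ x → to (from x) ≡ x
  to∘from ([] , z , (refl , n)) = refl
  to∘from (true ∷ M , z) = refl
  to∘from (false ∷ M , z) = refl
  from∘to : ∀ x → from (to x) ≡ x
  from∘to ([] , z , (refl , n)) = refl
  from∘to (true ∷ M , z) = refl
  from∘to (false ∷ M , z) = refl

CE-tf-tt : ∀ S U → CE true false (true ∷ S) (true ∷ U) ↔ Free S U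
CE-tf-tt S U = mk↔ₛ′ to from to∘from from∘to
  where
  to : CE true false (true ∷ S) (true ∷ U) → Free S U
  to ([] , (_ , n) , z) = [] , (refl , n) , z
  to (true ∷ M , z) = true ∷ M , z
  to (false ∷ M , z) = false ∷ M , z
  from : Free S U → CE true false (true ∷ S) (true ∷ U)
  from ([] , (_ , n) , z) = [] , (refl , n) , z
  from (true ∷ M , z) = true ∷ M , z
  from (false ∷ M , z) = false ∷ M , z
  to∘from : ∀ x → to (from x) ≡ x
  to∘from ([] , (refl , n) , z) = refl
  to∘from (true ∷ M , z) = refl
  to∘from (false ∷ M , z) = refl
  from∘to : ∀ x → from (to x) ≡ x
  from∘to ([] , (refl , n) , z) = refl
  from∘to (true ∷ M , z) = refl
  from∘to (false ∷ M , z) = refl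

CE-ft-tf : ∀ S U → CE false true (true ∷ S) (false ∷ U) ↔ CE false false S U
CE-ft-tf S U = mk↔ₛ′ to (λ { (M , z) → true ∷ M , z }) (λ _ → refl) inv
  where
  to : CE false true (true ∷ S) (false ∷ U) → CE false false S U
  to ([] , (() , _) , _)
  to (true ∷ M , z) = M , z
  inv : ∀ x → (true ∷ proj₁ (to x) , proj₂ (to x)) ≡ x
  inv ([] , (() , _) , _)
  inv (true ∷ M , z) = refl

CE-tf-tf : ∀ S U → CE true false (true ∷ S) (false ∷ U) ↔ CE false false S U
CE-tf-tf S U = mk↔ₛ′ to (λ { (M , z) → false ∷ M , z }) (λ _ → refl) inv
  where
  to : CE true false (true ∷ S) (false ∷ U) → CE false false S U
  to ([] , _ , (() , _))
  to (false ∷ M , z) = M , z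
  inv : ∀ x → (false ∷ proj₁ (to x) , proj₂ (to x)) ≡ x
  inv ([] , _ , (() , _))
  inv (false ∷ M , z) = refl

¬CE-t-f : ∀ {d} S U → ¬ CE true d (false ∷ S) U
¬CE-t-f S U ([] , (() , _) , _)

¬CE-ft-t : ∀ {c} S U → ¬ CE c true S (true ∷ U)
¬CE-ft-t S U ([] , _ , (() , _))

¬CE-ff-tf : ∀ S U → ¬ CE false false (true ∷ S) (false ∷ U)
¬CE-ff-tf S U ([] , (() , _) , _)
¬CE-ff-tf S U (true ∷ M , z , ())

-- The free entry is covered on exactly one of the two paths, being complemented on the second, and
-- there it must be matched to the right.
Free-∷ : ∀ s S u U → Free (s ∷ S) (u ∷ U) ↔ (CE false true (s ∷ S) (u ∷ U) ⊎ CE true false (s ∷ S) (u ∷ U))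
Free-∷ s S u U = mk↔ₛ′
  (λ { ([] , (_ , ()) , _) ; (false ∷ M , z) → inj₁ (M , z) ; (true ∷ M , z) → inj₂ (M , z) })
  (λ { (inj₁ (M , z)) → false ∷ M , z ; (inj₂ (M , z)) → true ∷ M , z })
  (λ { (inj₁ _) → refl ; (inj₂ _) → refl })
  (λ { ([] , (_ , ()) , _) ; (false ∷ M , z) → refl ; (true ∷ M , z) → refl })

⊎-⊥ʳ : ∀ {A B : Set} → ¬ B → (A ⊎ B) ↔ A
⊎-⊥ʳ nb = mk↔ₛ′ (λ { (inj₁ a) → a ; (inj₂ b) → ⊥-elim (nb b) }) inj₁ (λ _ → refl)
  (λ { (inj₁ a) → refl ; (inj₂ b) → ⊥-elim (nb b) })

⊎-⊥ˡ : ∀ {A B : Set} → ¬ A → (A ⊎ B) ↔ B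
⊎-⊥ˡ na = mk↔ₛ′ (λ { (inj₂ b) → b ; (inj₁ a) → ⊥-elim (na a) }) inj₂ (λ _ → refl)
  (λ { (inj₂ b) → refl ; (inj₁ a) → ⊥-elim (na a) })

-- The factor 2: at the first position where S and U differ, EC branches into the
-- carries (1,0) and (0,1), which have equally many continuations, whereas CE has
-- only one such branch.
EC↔Bool×CE : ∀ S U → EC false false S U ↔ (Bool × CE false false S U)
-- Compares the continuations after a disagreement. At `s = true`, `u = false` both branches of
-- `Free` reach the same `CE`, and these two copies match the factor 2 that `EC` acquires again; in
-- all other cases at most one branch survives.
Free↔EC : ∀ S U → Free S U ↔ EC true false S U

EC↔Bool×CE [] [] = ⊥↔ (λ { (true ∷ M , _ , (() , _)) ; (false ∷ M , (() , _) , _) }) (λ x → ¬CE[] false false [] (proj₂ x))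
EC↔Bool×CE [] (u ∷ U) = ⊥↔ (λ x → contradiction (EC-length false false [] (u ∷ U) x) λ ()) (λ x → ¬CE[] false false (u ∷ U) (proj₂ x))
EC↔Bool×CE (s ∷ S) [] =
  ⊥↔ (λ x → contradiction (EC-length false false (s ∷ S) [] x) λ ()) (λ x → contradiction (CE-length false false (s ∷ S) [] (proj₂ x)) λ ())
EC↔Bool×CE (false ∷ S) (false ∷ U) =
  ↔-trans (EC-ff-same false S U) (↔-trans (EC↔Bool×CE S U) (↔-refl ×-↔ ↔-sym (CE-ff-same false S U)))
EC↔Bool×CE (true ∷ S) (true ∷ U) =
  ↔-trans (EC-ff-same true S U) (↔-trans (EC↔Bool×CE S U) (↔-refl ×-↔ ↔-sym (CE-ff-same true S U)))
EC↔Bool×CE (false ∷ S) (true ∷ U) =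
  ↔-trans (EC-ff-ft S U) (↔-trans (↔-refl ⊎-↔ EC-ft↔tf S U)
  (↔-trans (↔-sym (Free↔EC S U) ⊎-↔ ↔-sym (Free↔EC S U)) (↔-sym Bool×↔⊎)))
EC↔Bool×CE (true ∷ S) (false ∷ U) = ⊥↔ (¬EC-ff-tf S U) (λ x → ¬CE-ff-tf S U (proj₂ x))

Free↔EC [] [] = mk↔ₛ′ (λ _ → false ∷ [] , (refl , tt) , (refl , tt)) (λ _ → [] , (refl , tt) , (refl , tt))
  (λ { (false ∷ [] , (refl , tt) , (refl , tt)) → refl }) inv
  where
  inv : ∀ x → ([] , (refl , tt) , (refl , tt)) ≡ x
  inv ([] , (refl , tt) , (refl , tt)) = refl
  inv (false ∷ M , () , _)
  inv (true ∷ M , () , _)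
Free↔EC [] (u ∷ U) =
  ⊥↔ (λ x → contradiction (CE-length false false (false ∷ []) (true ∷ u ∷ U) x) λ ()) (λ x → contradiction (EC-length true false [] (u ∷ U) x) λ ())
Free↔EC (s ∷ S) [] =
  ⊥↔ (λ x → contradiction (CE-length false false (false ∷ s ∷ S) (true ∷ []) x) λ ()) (λ x → contradiction (EC-length true false (s ∷ S) [] x) λ ())
Free↔EC (s ∷ S) (u ∷ U) = ↔-trans (Free-∷ s S u U) (↔-trans (step s u) (↔-sym (EC-tf s S u U)))
  where
  step : ∀ s u → (CE false true (s ∷ S) (u ∷ U) ⊎ CE true false (s ∷ S) (u ∷ U)) ↔ EC (not s) u S U
  step false false = ↔-trans (⊎-⊥ʳ (¬CE-t-f S (false ∷ U))) (↔-trans (CE-ft-ff S U) (Free↔EC S U))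
  step true true =
    ↔-trans (⊎-⊥ˡ (¬CE-ft-t (true ∷ S) U)) (↔-trans (CE-tf-tt S U) (↔-trans (Free↔EC S U) (↔-sym (EC-ft↔tf S U))))
  step true false = ↔-trans (CE-ft-tf S U ⊎-↔ CE-tf-tf S U) (↔-trans (↔-sym Bool×↔⊎) (↔-sym (EC↔Bool×CE S U)))
  step false true = ⊥↔ (λ { (inj₁ x) → ¬CE-ft-t (false ∷ S) U x ; (inj₂ x) → ¬CE-t-f S (true ∷ U) x }) (¬EC-tt S U)

-- Words, chains of states, and sorting a word

-- Row r carries the letter ex if its lower cells are white (row r + 1 is then
-- one longer) and co if they are black (row r + 1 is one shorter).
data Letter : Set where
  ex co : Letter

Step : Letter → List Bool → List Bool → Set
Step ex = Expand
Step co = Contract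

-- The all-`true` end state encodes that no cell of the bottom row is matched downwards: that row
-- carries the letter `ex`, so the absence of a partner is stored as `true`.
Chain : List Letter → List Bool → Set
Chain [] S = S ≡ replicate (length S) true
Chain (x ∷ w) S = Σ (List Bool) λ M → Step x S M × Chain w M

Σ-cong : ∀ {I : Set} {A B : I → Set} → (∀ i → A i ↔ B i) → Σ I A ↔ Σ I B
Σ-cong f = Σ-↔ ↔-refl (λ {i} → f i)

Chain-swap : ∀ w S → Chain (ex ∷ co ∷ w) S ↔ (Bool × Chain (co ∷ ex ∷ w) S)
Chain-swap w S = ↔-trans gather (↔-trans (Σ-cong λ U → EC↔Bool×CE S U ×-↔ ↔-refl) scatter)
  where
  gather : Chain (ex ∷ co ∷ w) S ↔ (Σ (List Bool) λ U → EC false false S U × Chain w U)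
  gather = mk↔ₛ′ (λ { (M , p , U , q , c) → U , (M , p , q) , c }) (λ { (U , (M , p , q) , c) → M , p , U , q , c })
    (λ _ → refl) (λ _ → refl)
  scatter : (Σ (List Bool) λ U → (Bool × CE false false S U) × Chain w U) ↔ (Bool × Chain (co ∷ ex ∷ w) S)
  scatter = mk↔ₛ′ (λ { (U , (x , M , p , q) , c) → x , M , p , U , q , c })
    (λ { (x , M , p , U , q , c) → U , (x , M , p , q) , c }) (λ _ → refl) (λ _ → refl)

Chain-pull : ∀ i w S → Chain (replicate i ex ++ co ∷ w) S ↔ (Fin (2 ^ i) × Chain (co ∷ replicate i ex ++ w) S)
Chain-pull zero w S = mk↔ₛ′ (λ c → Fin.zero , c) proj₂ (λ { (Fin.zero , c) → refl ; (Fin.suc () , _) }) (λ _ → refl)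
Chain-pull (suc i) w S =
  ↔-trans (Σ-cong λ M → ↔-refl ×-↔ Chain-pull i w M)
  (↔-trans shuffle (↔-trans (↔-refl ×-↔ Chain-swap (replicate i ex ++ w) S)
  (↔-trans regroup ((↔-trans (↔-sym 2↔Bool ×-↔ ↔-refl) (↔-sym (*↔× {2} {2 ^ i}))) ×-↔ ↔-refl))))
  where
  v = replicate i ex ++ w
  shuffle : (Σ (List Bool) λ M → Expand S M × (Fin (2 ^ i) × Chain (co ∷ v) M)) ↔ (Fin (2 ^ i) × Chain (ex ∷ co ∷ v) S)
  shuffle = mk↔ₛ′ (λ { (M , p , k , c) → k , M , p , c }) (λ { (k , M , p , c) → M , p , k , c }) (λ _ → refl) (λ _ → refl)
  regroup : ∀ {A B C : Set} → (A × (B × C)) ↔ ((B × A) × C)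
  regroup = mk↔ₛ′ (λ { (a , b , c) → (b , a) , c }) (λ { ((b , a) , c) → a , b , c }) (λ _ → refl) (λ _ → refl)

contract-falses : ∀ n → Contract (replicate (suc n) false) (replicate n false)
contract-falses zero = refl , tt
contract-falses (suc n) = contract-falses n

-- A covered white vertex would need a covered black neighbour, and no black vertex is covered. The
-- mirror argument gives `expand-trues-unique`, where after complementing no white vertex is
-- covered.
contract-falses-unique : ∀ n M → Contract (replicate (suc n) false) M → replicate n false ≡ M
contract-falses-unique zero [] z = refl
contract-falses-unique (suc n) (false ∷ M) z = cong (false ∷_) (contract-falses-unique n M z)
contract-falses-unique (suc n) (true ∷ []) ()
contract-falses-unique (suc n) (true ∷ _ ∷ M) ()

expand-trues : ∀ n → Expand (replicate n true) (replicate (suc n) true)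
expand-trues zero = refl , tt
expand-trues (suc n) = expand-trues n

expand-trues-unique : ∀ n M → Expand (replicate n true) M → replicate (suc n) true ≡ M
expand-trues-unique zero (true ∷ []) z = refl
expand-trues-unique (suc n) (true ∷ M) z = cong (true ∷_) (expand-trues-unique n M z)

Step-irrelevant : ∀ x S M (p q : Step x S M) → p ≡ q
Step-irrelevant ex S M = Interlace-irrelevant false (map not S) (map not M)
Step-irrelevant co S M = Interlace-irrelevant false M S

Chain-unique-step : ∀ x w S M → Step x S M → (∀ M′ → Step x S M′ → M ≡ M′) → Chain (x ∷ w) S ↔ Chain w M
Chain-unique-step x w S M p u = mk↔ₛ′ to (λ c → M , p , c) to∘from from∘to
  where
  to : Chain (x ∷ w) S → Chain w M
  to (M′ , q , c) = subst (Chain w) (sym (u M′ q)) c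
  to∘from : ∀ c → to (M , p , c) ≡ c
  to∘from c with u M p
  ... | refl = refl
  from∘to : ∀ y → (M , p , to y) ≡ y
  from∘to (M′ , q , c) with u M′ q
  ... | refl = cong (λ r → M , r , c) (Step-irrelevant x S M p q)

#co : List Letter → ℕ
#co [] = 0
#co (ex ∷ w) = #co w
#co (co ∷ w) = suc (#co w)

-- The number of pairs (ex before co), counting i extra letters ex in front.
inversions : ℕ → List Letter → ℕ
inversions i [] = 0
inversions i (ex ∷ w) = inversions (suc i) w
inversions i (co ∷ w) = i + inversions i w

replicate-snoc : ∀ i w → replicate i ex ++ ex ∷ w ≡ replicate (suc i) ex ++ w
replicate-snoc zero w = refl
replicate-snoc (suc i) w = cong (ex ∷_) (replicate-snoc i w)

List-irrelevant : ∀ {S U : List Bool} (p q : S ≡ U) → p ≡ q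
List-irrelevant = Decidable⇒UIP.≡-irrelevant (≡-dec _≟ᵇ_)

Chain-trues : ∀ i n → Chain (replicate i ex ++ []) (replicate n true) ↔ Fin 1
Chain-trues zero n = mk↔ₛ′ (λ _ → Fin.zero) (λ _ → trues n) (λ { Fin.zero → refl ; (Fin.suc ()) }) (List-irrelevant _)
  where
  trues : ∀ n → replicate n true ≡ replicate (length (replicate n true)) true
  trues zero = refl
  trues (suc n) = cong (true ∷_) (trues n)
Chain-trues (suc i) n =
  ↔-trans (Chain-unique-step ex _ _ _ (expand-trues n) (expand-trues-unique n)) (Chain-trues i (suc n))

^-+-* : ∀ i j → (Fin (2 ^ i) × Fin (2 ^ j)) ↔ Fin (2 ^ (i + j))
^-+-* i j rewrite ^-distribˡ-+-* 2 i j = ↔-sym *↔×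

-- The prefix of `i` letters `ex` makes the induction on `w` go through: a letter `ex` joins the
-- prefix, and a letter `co` is pulled through it at the cost of `2 ^ i` and then shortens the
-- all-`false` start by one.
Chain-count : ∀ w i → Chain (replicate i ex ++ w) (replicate (#co w) false) ↔ Fin (2 ^ inversions i w)
-- No `co` is left, so the start is the empty row, which is also all `true`.
Chain-count [] i = Chain-trues i 0
Chain-count (ex ∷ w) i rewrite replicate-snoc i w = Chain-count w (suc i)
Chain-count (co ∷ w) i =
  ↔-trans (Chain-pull i w (replicate (suc (#co w)) false))
  (↔-trans (↔-refl ×-↔ ↔-trans
      (Chain-unique-step co (replicate i ex ++ w) (replicate (suc (#co w)) false) (replicate (#co w) false) (contract-falses (#co w)) (contract-falses-unique (#co w)))
      (Chain-count w i))
    (^-+-* i (inversions i w)))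

-- Explicit matchings of a path versus coverings

data Side : Set where
  none left right : Side

covered : Side → Bool
covered none = false
covered _ = true

isLeft : Side → Bool
isLeft left = true
isLeft _ = false

notLeft : ∀ {s} → s ≢ left → isLeft s ≡ false
notLeft {none} p = refl
notLeft {right} p = refl
notLeft {left} p = ⊥-elim (p refl)

tab : ℕ → (ℕ → Bool) → List Bool
tab zero g = []
tab (suc n) g = g 0 ∷ tab n (λ i → g (suc i))

get : List Bool → ℕ → Bool
get [] i = false
get (b ∷ B) zero = b
get (b ∷ B) (suc i) = get B i

length-tab : ∀ n g → length (tab n g) ≡ n
length-tab zero g = refl
length-tab (suc n) g = cong suc (length-tab n _)

tab-cong : ∀ n {g g′} → (∀ i → i < n → g i ≡ g′ i) → tab n g ≡ tab n g′
tab-cong zero e = refl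
tab-cong (suc n) e = cong₂ _∷_ (e 0 (s≤s z≤n)) (tab-cong n λ i i<n → e (suc i) (s≤s i<n))

tab-get : ∀ n B → length B ≡ n → tab n (get B) ≡ B
tab-get zero [] e = refl
tab-get (suc n) (b ∷ B) e = cong (b ∷_) (tab-get n B (suc-injective e))

tab-const : ∀ n c → tab n (λ _ → c) ≡ replicate n c
tab-const zero c = refl
tab-const (suc n) c = cong (c ∷_) (tab-const n c)

map-tab : ∀ (φ : Bool → Bool) n g → map φ (tab n g) ≡ tab n (λ i → φ (g i))
map-tab φ zero g = refl
map-tab φ (suc n) g = cong (φ (g 0) ∷_) (map-tab φ n _)

get-map-not : ∀ B i → i < length B → get (map not B) i ≡ not (get B i)
get-map-not (b ∷ B) zero p = refl
get-map-not (b ∷ B) (suc i) (s≤s p) = get-map-not B i p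

get-replicate : ∀ n c i → i < n → get (replicate n c) i ≡ c
get-replicate (suc n) c zero p = refl
get-replicate (suc n) c (suc i) (s≤s p) = get-replicate n c i p

-- A matching of the path b₀ w₀ b₁ w₁ … wₙ₋₁ bₙ, given by the side on which
-- each vertex has its partner; b₀ may still be matched to the left.
record Zig (n : ℕ) (w b : ℕ → Side) : Set where
  field
    w-left  : ∀ i → i < n → w i ≡ left → b i ≡ right
    w-right : ∀ i → i < n → w i ≡ right → b (suc i) ≡ left
    b-left  : ∀ i → i < n → b (suc i) ≡ left → w i ≡ right
    b-right : ∀ i → i < n → b i ≡ right → w i ≡ left
    b-last  : b n ≢ right

open Zig

Zig-tail : ∀ {n w b} → Zig (suc n) w b → Zig n (λ i → w (suc i)) (λ i → b (suc i))
Zig-tail z = record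
  { w-left  = λ i p → w-left z (suc i) (s≤s p)
  ; w-right = λ i p → w-right z (suc i) (s≤s p)
  ; b-left  = λ i p → b-left z (suc i) (s≤s p)
  ; b-right = λ i p → b-right z (suc i) (s≤s p)
  ; b-last  = b-last z }

-- The carry after a pair `b`, `w`: a covered `b` without carry takes `w` as its partner and passes
-- nothing on; otherwise a covered `w` must look to the right.
next : Bool → Bool → Bool → Bool
next false true w = false
next _ _ w = w

wSide : Bool → List Bool → List Bool → ℕ → Side
wSide c (w ∷ W) (b ∷ B) zero = if w then (if next c b w then right else left) else none
wSide c (w ∷ W) (b ∷ B) (suc i) = wSide (next c b w) W B i
wSide c _ _ i = none

bSide : Bool → List Bool → List Bool → ℕ → Side
bSide c W (b ∷ B) zero = if b then (if c then left else right) else none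
bSide c (w ∷ W) (b ∷ B) (suc i) = bSide (next c b w) W B i
bSide c _ _ i = none

-- The four inhabited clauses of `Interlace`, so that later inductions need not refute the empty
-- ones.
data InterlaceView : Bool → List Bool → List Bool → Set where
  stop : ∀ c → InterlaceView c [] (c ∷ [])
  skip : ∀ w W B → Interlace w W B → InterlaceView false (w ∷ W) (false ∷ B)
  join : ∀ W B → Interlace false W B → InterlaceView false (true ∷ W) (true ∷ B)
  done : ∀ w W B → Interlace w W B → InterlaceView true (w ∷ W) (true ∷ B)

interlaceView : ∀ c W B → Interlace c W B → InterlaceView c W B
interlaceView c [] (b ∷ []) (refl , _) = stop c
interlaceView false (w ∷ W) (false ∷ B) z = skip w W B z
interlaceView false (true ∷ W) (true ∷ B) z = join W B z
interlaceView true (w ∷ W) (true ∷ B) z = done w W B z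

-- Gives the carry its meaning in the rebuilt matching. With carry `false` it says that the first
-- black vertex has no partner before the start of the path.
head-carry : ∀ c W B → Interlace c W B → isLeft (bSide c W B 0) ≡ c
head-carry c W B z with interlaceView c W B z
... | stop false = refl
... | stop true = refl
... | skip w W B z′ = refl
... | join W B z′ = refl
... | done w W B z′ = refl

isLeft⇒ : ∀ {s} → isLeft s ≡ true → s ≡ left
isLeft⇒ {left} e = refl

⇒isLeft : ∀ {s c} → s ≡ left → isLeft s ≡ c → c ≡ true
⇒isLeft refl e = sym e

Interlace⇒Zig : ∀ c W B → Interlace c W B → Zig (length W) (wSide c W B) (bSide c W B)
Interlace⇒Zig c W B z = record { w-left = wl c W B z ; w-right = wr c W B z ; b-left = bl c W B z ; b-right = br c W B z ; b-last = bn c W B z }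
  where
  wl : ∀ c W B → Interlace c W B → ∀ i → i < length W → wSide c W B i ≡ left → bSide c W B i ≡ right
  wl c W B z i p e with interlaceView c W B z
  wl c W B z zero p () | skip false W′ B′ z′
  wl c W B z zero p () | skip true W′ B′ z′
  wl c W B z (suc i) (s≤s p) e | skip w W′ B′ z′ = wl w W′ B′ z′ i p e
  wl c W B z zero p e | join W′ B′ z′ = refl
  wl c W B z (suc i) (s≤s p) e | join W′ B′ z′ = wl false W′ B′ z′ i p e
  wl c W B z zero p () | done false W′ B′ z′
  wl c W B z zero p () | done true W′ B′ z′
  wl c W B z (suc i) (s≤s p) e | done w W′ B′ z′ = wl w W′ B′ z′ i p e
  wr : ∀ c W B → Interlace c W B → ∀ i → i < length W → wSide c W B i ≡ right → bSide c W B (suc i) ≡ left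
  wr c W B z i p e with interlaceView c W B z
  wr c W B z zero p e | skip true W′ B′ z′ = isLeft⇒ (head-carry true W′ B′ z′)
  wr c W B z (suc i) (s≤s p) e | skip w W′ B′ z′ = wr w W′ B′ z′ i p e
  wr c W B z (suc i) (s≤s p) e | join W′ B′ z′ = wr false W′ B′ z′ i p e
  wr c W B z zero p e | done true W′ B′ z′ = isLeft⇒ (head-carry true W′ B′ z′)
  wr c W B z (suc i) (s≤s p) e | done w W′ B′ z′ = wr w W′ B′ z′ i p e
  bl : ∀ c W B → Interlace c W B → ∀ i → i < length W → bSide c W B (suc i) ≡ left → wSide c W B i ≡ right
  bl c W B z i p e with interlaceView c W B z
  bl c W B z zero p e | skip w W′ B′ z′ with ⇒isLeft e (head-carry w W′ B′ z′)
  ... | refl = refl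
  bl c W B z (suc i) (s≤s p) e | skip w W′ B′ z′ = bl w W′ B′ z′ i p e
  bl c W B z zero p e | join W′ B′ z′ with ⇒isLeft e (head-carry false W′ B′ z′)
  ... | ()
  bl c W B z (suc i) (s≤s p) e | join W′ B′ z′ = bl false W′ B′ z′ i p e
  bl c W B z zero p e | done w W′ B′ z′ with ⇒isLeft e (head-carry w W′ B′ z′)
  ... | refl = refl
  bl c W B z (suc i) (s≤s p) e | done w W′ B′ z′ = bl w W′ B′ z′ i p e
  br : ∀ c W B → Interlace c W B → ∀ i → i < length W → bSide c W B i ≡ right → wSide c W B i ≡ left
  br c W B z i p e with interlaceView c W B z
  br c W B z (suc i) (s≤s p) e | skip w W′ B′ z′ = br w W′ B′ z′ i p e
  br c W B z zero p e | join W′ B′ z′ = refl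
  br c W B z (suc i) (s≤s p) e | join W′ B′ z′ = br false W′ B′ z′ i p e
  br c W B z (suc i) (s≤s p) e | done w W′ B′ z′ = br w W′ B′ z′ i p e
  bn : ∀ c W B → Interlace c W B → bSide c W B (length W) ≢ right
  bn c W B z e with interlaceView c W B z
  bn c W B z () | stop false
  bn c W B z () | stop true
  bn c W B z e | skip w W′ B′ z′ = bn w W′ B′ z′ e
  bn c W B z e | join W′ B′ z′ = bn false W′ B′ z′ e
  bn c W B z e | done w W′ B′ z′ = bn w W′ B′ z′ e

covered-wSide : ∀ c W B → Interlace c W B → ∀ i → covered (wSide c W B i) ≡ get W i
covered-wSide c W B z i with interlaceView c W B z
covered-wSide c W B z i | stop _ = refl
covered-wSide c W B z zero | skip false W′ B′ z′ = refl
covered-wSide c W B z zero | skip true W′ B′ z′ = refl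
covered-wSide c W B z (suc i) | skip w W′ B′ z′ = covered-wSide w W′ B′ z′ i
covered-wSide c W B z zero | join W′ B′ z′ = refl
covered-wSide c W B z (suc i) | join W′ B′ z′ = covered-wSide false W′ B′ z′ i
covered-wSide c W B z zero | done false W′ B′ z′ = refl
covered-wSide c W B z zero | done true W′ B′ z′ = refl
covered-wSide c W B z (suc i) | done w W′ B′ z′ = covered-wSide w W′ B′ z′ i

covered-bSide : ∀ c W B → Interlace c W B → ∀ i → covered (bSide c W B i) ≡ get B i
covered-bSide c W B z i with interlaceView c W B z
covered-bSide c W B z zero | stop false = refl
covered-bSide c W B z zero | stop true = refl
covered-bSide c W B z (suc i) | stop _ = refl
covered-bSide c W B z zero | skip w W′ B′ z′ = refl
covered-bSide c W B z (suc i) | skip w W′ B′ z′ = covered-bSide w W′ B′ z′ i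
covered-bSide c W B z zero | join W′ B′ z′ = refl
covered-bSide c W B z (suc i) | join W′ B′ z′ = covered-bSide false W′ B′ z′ i
covered-bSide c W B z zero | done w W′ B′ z′ = refl
covered-bSide c W B z (suc i) | done w W′ B′ z′ = covered-bSide w W′ B′ z′ i

-- All consistent configurations of the first three vertices of a path. In each of them, whether the
-- third vertex is matched to the left is known, and this is the carry for the tail.
data ZigHead : Side → Side → Side → Set where
  h-none  : ∀ {b₁} → isLeft b₁ ≡ false → ZigHead none none b₁
  h-step  : ZigHead none right left
  h-match : ∀ {b₁} → isLeft b₁ ≡ false → ZigHead right left b₁
  h-left  : ∀ {b₁} → isLeft b₁ ≡ false → ZigHead left none b₁
  h-both  : ZigHead left right left

zigHead : ∀ {n w b} → Zig (suc n) w b → ZigHead (b 0) (w 0) (b 1)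
zigHead {n} {w} {b} z = go (b 0) (w 0) (b 1) refl refl refl
  where
  0<  : 0 < suc n
  0< = s≤s z≤n
  go : ∀ x y v → b 0 ≡ x → w 0 ≡ y → b 1 ≡ v → ZigHead x y v
  go none none v p q r = h-none (notLeft λ e → contradiction (trans (sym q) (b-left z 0 0< (trans r e))) λ ())
  go left none v p q r = h-left (notLeft λ e → contradiction (trans (sym q) (b-left z 0 0< (trans r e))) λ ())
  go right none v p q r = contradiction (trans (sym q) (b-right z 0 0< p)) λ ()
  go none left v p q r = contradiction (trans (sym p) (w-left z 0 0< q)) λ ()
  go left left v p q r = contradiction (trans (sym p) (w-left z 0 0< q)) λ ()
  go right left v p q r = h-match (notLeft λ e → contradiction (trans (sym q) (b-left z 0 0< (trans r e))) λ ())
  go right right v p q r = contradiction (trans (sym q) (b-right z 0 0< p)) λ ()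
  go none right v p q r with trans (sym r) (w-right z 0 0< q)
  ... | refl = h-step
  go left right v p q r with trans (sym r) (w-right z 0 0< q)
  ... | refl = h-both

covers : ℕ → (ℕ → Side) → List Bool
covers n s = tab n (λ i → covered (s i))

Zig⇒Interlace : ∀ n w b → Zig n w b → Interlace (isLeft (b 0)) (covers n w) (covers (suc n) b)
Zig⇒Interlace zero w b z with b 0 | b-last z
... | none | _ = refl , tt
... | left | _ = refl , tt
... | right | r = ⊥-elim (r refl)
Zig⇒Interlace (suc n) w b z with Zig⇒Interlace n _ _ (Zig-tail z)
... | ih with b 0 | w 0 | b 1 | zigHead z
... | _ | _ | v | h-none e = subst (λ c → Interlace c (covers n λ i → w (suc i)) (covered v ∷ covers n λ i → b (suc (suc i)))) e ih
... | _ | _ | _ | h-step = ih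
... | _ | _ | v | h-match e = subst (λ c → Interlace c (covers n λ i → w (suc i)) (covered v ∷ covers n λ i → b (suc (suc i)))) e ih
... | _ | _ | v | h-left e = subst (λ c → Interlace c (covers n λ i → w (suc i)) (covered v ∷ covers n λ i → b (suc (suc i)))) e ih
... | _ | _ | _ | h-both = ih

Zig-next : ∀ {n w b} → Zig (suc n) w b → next (isLeft (b 0)) (covered (b 0)) (covered (w 0)) ≡ isLeft (b 1)
Zig-next {n} {w} {b} z with b 0 | w 0 | b 1 | zigHead z
... | _ | _ | _ | h-none e = sym e
... | _ | _ | _ | h-step = refl
... | _ | _ | _ | h-match e = sym e
... | _ | _ | _ | h-left e = sym e
... | _ | _ | _ | h-both = refl

bSide-covers : ∀ n w b → Zig n w b → ∀ i → i < suc n → bSide (isLeft (b 0)) (covers n w) (covers (suc n) b) i ≡ b i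
bSide-covers n w b z zero p with b 0
... | none = refl
... | left = refl
... | right = refl
bSide-covers (suc n) w b z (suc i) (s≤s p) rewrite Zig-next z = bSide-covers n _ _ (Zig-tail z) i p
bSide-covers zero w b z (suc i) (s≤s ())

wSide-covers : ∀ n w b → Zig n w b → ∀ i → i < n → wSide (isLeft (b 0)) (covers n w) (covers (suc n) b) i ≡ w i
wSide-covers (suc n) w b z zero p with b 0 | w 0 | b 1 | zigHead z
... | _ | _ | _ | h-none e = refl
... | _ | _ | _ | h-step = refl
... | _ | _ | _ | h-match e = refl
... | _ | _ | _ | h-left e = refl
... | _ | _ | _ | h-both = refl
wSide-covers (suc n) w b z (suc i) (s≤s p) rewrite Zig-next z = wSide-covers n _ _ (Zig-tail z) i p

-- Side assignments on all rows versus chains of states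

word : (ℕ → Letter) → ℕ → List Letter
word f zero = []
word f (suc k) = f 0 ∷ word (λ j → f (suc j)) k

rowAt : ∀ w S → Chain w S → ℕ → List Bool
rowAt w S c zero = S
-- This default is used: it supplies the empty row below the bottom one, which makes `lower` yield
-- `none` there.
rowAt [] S c (suc j) = []
rowAt (x ∷ w) S (M , p , c) (suc j) = rowAt w M c j

rowAt-step : ∀ f k S (c : Chain (word f k) S) j → j < k →
  Step (f j) (rowAt (word f k) S c j) (rowAt (word f k) S c (suc j))
rowAt-step f (suc k) S (M , p , c) zero j<k = p
rowAt-step f (suc k) S (M , p , c) (suc j) (s≤s j<k) = rowAt-step (λ j → f (suc j)) k M c j j<k

rowAt-last : ∀ f k S (c : Chain (word f k) S) →
  let R = rowAt (word f k) S c k in R ≡ replicate (length R) true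
rowAt-last f zero S c = c
rowAt-last f (suc k) S (M , p , c) = rowAt-last (λ j → f (suc j)) k M c

rowAt-beyond : ∀ f k S (c : Chain (word f k) S) → rowAt (word f k) S c (suc k) ≡ []
rowAt-beyond f zero S c = refl
rowAt-beyond f (suc k) S (M , p , c) = rowAt-beyond (λ j → f (suc j)) k M c

mkChain : ∀ f k (R : ℕ → List Bool) S → R 0 ≡ S → (∀ j → j < k → Step (f j) (R j) (R (suc j))) →
  R k ≡ replicate (length (R k)) true → Chain (word f k) S
mkChain f zero R S refl s l = l
mkChain f (suc k) R S refl s l =
  R 1 , s 0 (s≤s z≤n) , mkChain (λ j → f (suc j)) k (λ j → R (suc j)) (R 1) refl (λ j j<k → s (suc j) (s≤s j<k)) l

rowAt-mkChain : ∀ f k R S e s l j → j ≤ k → rowAt (word f k) S (mkChain f k R S e s l) j ≡ R j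
rowAt-mkChain f zero R S refl s l zero p = refl
rowAt-mkChain f (suc k) R S refl s l zero p = refl
rowAt-mkChain f (suc k) R S refl s l (suc j) (s≤s p) =
  rowAt-mkChain (λ j → f (suc j)) k (λ j → R (suc j)) (R 1) refl (λ j j<k → s (suc j) (s≤s j<k)) l j p

Chain-ext : ∀ f k S (c c′ : Chain (word f k) S) →
  (∀ j → j ≤ k → rowAt (word f k) S c j ≡ rowAt (word f k) S c′ j) → c ≡ c′
Chain-ext f zero S c c′ e = List-irrelevant c c′
Chain-ext f (suc k) S (M , p , c) (M′ , p′ , c′) e with e 1 (s≤s z≤n)
... | refl = cong₂ (λ p c → M , p , c) (Step-irrelevant (f 0) S M p p′)
               (Chain-ext (λ j → f (suc j)) k M c c′ λ j j≤k → e (suc j) (s≤s j≤k))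

flip : Letter → Letter
flip ex = co
flip co = ex

-- The states of a chain are the cells matched downwards, complemented at ex.
signed : Letter → Bool → Bool
signed ex b = not b
signed co b = b

signed-involutive : ∀ x b → signed x (signed x b) ≡ b
signed-involutive ex b = not-involutive b
signed-involutive co b = refl

Height : Letter → ℕ → ℕ → Set
Height ex m n = n ≡ suc m
Height co m n = m ≡ suc n

-- The longer row holds the black vertices. The extra condition excludes a partner to the left of
-- the first black vertex; the right end is handled by `b-last`.
ZigAt : Letter → ℕ → ℕ → (los ups : ℕ → Side) → Set
ZigAt ex m n los ups = Zig m los ups × ups 0 ≢ left
ZigAt co m n los ups = Zig n ups los × los 0 ≢ left

bits : Letter → ℕ → (ℕ → Side) → List Bool
bits x n s = tab n (λ i → signed x (covered (s i)))

loSide upSide : Letter → List Bool → List Bool → ℕ → Side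
loSide ex S M = wSide false (map not S) (map not M)
loSide co S M = bSide false M S
upSide ex S M = bSide false (map not S) (map not M)
upSide co S M = wSide false M S

isLeft-false : ∀ {s} → isLeft s ≡ false → s ≢ left
isLeft-false () refl

map-not-bits : ∀ n s → map not (bits ex n s) ≡ covers n s
map-not-bits n s = trans (map-tab not n _) (tab-cong n λ i _ → not-involutive _)

Step-length : ∀ x S M → Step x S M → Height x (length S) (length M)
Step-length ex S M z = trans (sym (length-map not M)) (trans (Interlace-length _ (map not S) (map not M) z) (cong suc (length-map not S)))
Step-length co S M z = Interlace-length _ M S z

ZigAt⇒Step : ∀ x {m n los ups} → Height x m n → ZigAt x m n los ups → Step x (bits x m los) (bits x n ups)
ZigAt⇒Step ex {m} {n} {los} {ups} refl (z , e)
  rewrite map-not-bits m los | map-not-bits n ups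
  = subst (λ c → Interlace c (covers m los) (covers n ups)) (notLeft e) (Zig⇒Interlace m los ups z)
ZigAt⇒Step co {m} {n} {los} {ups} refl (z , e)
  = subst (λ c → Interlace c (covers n ups) (covers m los)) (notLeft e) (Zig⇒Interlace n ups los z)

Step⇒ZigAt : ∀ x S M → Step x S M → ZigAt x (length S) (length M) (loSide x S M) (upSide x S M)
Step⇒ZigAt ex S M z =
  subst (λ n → Zig n (loSide ex S M) (upSide ex S M)) (length-map not S) (Interlace⇒Zig false (map not S) (map not M) z) ,
  isLeft-false (head-carry false (map not S) (map not M) z)
Step⇒ZigAt co S M z = Interlace⇒Zig false M S z , isLeft-false (head-carry false M S z)

covered-loSide : ∀ x S M → Step x S M → ∀ i → i < length S → covered (loSide x S M i) ≡ signed x (get S i)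
covered-loSide ex S M z i p = trans (covered-wSide false (map not S) (map not M) z i) (get-map-not S i p)
covered-loSide co S M z i p = covered-bSide false M S z i

covered-upSide : ∀ x S M → Step x S M → ∀ i → i < length M → covered (upSide x S M i) ≡ signed x (get M i)
covered-upSide ex S M z i p = trans (covered-bSide false (map not S) (map not M) z i) (get-map-not M i p)
covered-upSide co S M z i p = covered-wSide false M S z i

loSide-bits : ∀ x {m n los ups} → Height x m n → ZigAt x m n los ups →
  ∀ i → i < m → loSide x (bits x m los) (bits x n ups) i ≡ los i
loSide-bits ex {m} {n} {los} {ups} refl (z , e) i p
  rewrite map-not-bits m los | map-not-bits n ups
  = subst (λ c → wSide c (covers m los) (covers n ups) i ≡ los i) (notLeft e) (wSide-covers m los ups z i p)
loSide-bits co {m} {n} {los} {ups} refl (z , e) i p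
  = subst (λ c → bSide c (covers n ups) (covers m los) i ≡ los i) (notLeft e) (bSide-covers n ups los z i p)

upSide-bits : ∀ x {m n los ups} → Height x m n → ZigAt x m n los ups →
  ∀ i → i < n → upSide x (bits x m los) (bits x n ups) i ≡ ups i
upSide-bits ex {m} {n} {los} {ups} refl (z , e) i p
  rewrite map-not-bits m los | map-not-bits n ups
  = subst (λ c → bSide c (covers m los) (covers n ups) i ≡ ups i) (notLeft e) (bSide-covers m los ups z i p)
upSide-bits co {m} {n} {los} {ups} refl (z , e) i p
  = subst (λ c → wSide c (covers n ups) (covers m los) i ≡ ups i) (notLeft e) (wSide-covers n ups los z i p)

-- For a cut row, the two triangles are both matched outwards or to each other. For an uncut row,
-- `u` and `l` belong to the same square, which has exactly one partner.
Joint : Bool → Side → Side → Set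
Joint true u l = covered u ≡ covered l
Joint false u l = covered u ≡ not (covered l)

uncovered : ∀ {s} → covered s ≡ false → s ≡ none
uncovered {none} e = refl

-- Why states are well defined: a cut preserves both the covering and the letter, a square
-- complements the covering and flips the letter, and the two changes cancel.
Joint⇒signed : ∀ x y c u l → y ≡ (if c then x else flip x) → Joint c u l → signed y (covered l) ≡ signed x (covered u)
Joint⇒signed x _ true u l refl j = cong (signed x) (sym j)
Joint⇒signed ex _ false u l refl j = trans (sym (not-involutive _)) (cong not (sym j))
Joint⇒signed co _ false u l refl j = sym j

signed⇒Joint : ∀ x y c u l → y ≡ (if c then x else flip x) → signed y (covered l) ≡ signed x (covered u) → Joint c u l
signed⇒Joint x _ true u l refl e =
  trans (sym (signed-involutive x _)) (trans (cong (signed x) (sym e)) (signed-involutive x _))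
signed⇒Joint ex _ false u l refl e = trans (sym (not-involutive _)) (cong not (sym e))
signed⇒Joint co _ false u l refl e = sym e

module Rows (N : ℕ) (f : ℕ → Letter) (h : ℕ → ℕ) (cut : ℕ → Bool)
  (f-zero : f 0 ≡ ex) (f-last : f N ≡ ex) (cut-zero : cut 0 ≡ false)
  (f-suc : ∀ r → r < N → f (suc r) ≡ (if cut (suc r) then f r else flip (f r)))
  (h-step : ∀ r → r < N → Height (f r) (h r) (h (suc r))) where

  record Valid (ups los : ℕ → ℕ → Side) : Set where
    field
      top    : ∀ i → i < h 0 → ups 0 i ≡ none
      bottom : ∀ i → i < h N → los N i ≡ none
      joint  : ∀ r → r ≤ N → ∀ i → i < h r → Joint (cut r) (ups r i) (los r i)
      zig    : ∀ r → r < N → ZigAt (f r) (h r) (h (suc r)) (los r) (ups (suc r))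

  open Valid

  sidesRow : (ℕ → ℕ → Side) → ℕ → List Bool
  sidesRow los r = bits (f r) (h r) (los r)

  sidesRow-suc : ∀ {ups los} → Valid ups los → ∀ r → r < N → sidesRow los (suc r) ≡ bits (f r) (h (suc r)) (ups (suc r))
  sidesRow-suc v r p = tab-cong (h (suc r)) λ i q → Joint⇒signed (f r) _ _ _ _ (f-suc r p) (joint v (suc r) p i q)

  sidesRow-zero : ∀ {ups los} → Valid ups los → sidesRow los 0 ≡ replicate (h 0) false
  sidesRow-zero {ups} {los} v =
    trans (tab-cong (h 0) λ i p → lemma f-zero cut-zero (top v i p) (joint v 0 z≤n i p)) (tab-const (h 0) false)
    where
    lemma : ∀ {x c u l} → x ≡ ex → c ≡ false → u ≡ none → Joint c u l → signed x (covered l) ≡ false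
    lemma refl refl refl j = sym j

  sidesRow-last : ∀ {ups los} → Valid ups los → sidesRow los N ≡ replicate (length (sidesRow los N)) true
  sidesRow-last {ups} {los} v = trans (tab-cong (h N) λ i p → cong₂ (λ x s → signed x (covered s)) f-last (bottom v i p))
    (trans (tab-const (h N) true) (cong (λ n → replicate n true) (sym (length-tab (h N) _))))

  Paths : Set
  Paths = Chain (word f N) (replicate (h 0) false)

  row : Paths → ℕ → List Bool
  row = rowAt (word f N) (replicate (h 0) false)

  toPaths : ∀ {ups los} → Valid ups los → Paths
  toPaths {ups} {los} v = mkChain f N (sidesRow los) _ (sidesRow-zero v)
    (λ r p → subst (Step (f r) (sidesRow los r)) (sym (sidesRow-suc v r p)) (ZigAt⇒Step (f r) (h-step r p) (zig v r p)))
    (sidesRow-last v)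

  row-toPaths : ∀ {ups los} (v : Valid ups los) r → r ≤ N → row (toPaths v) r ≡ sidesRow los r
  row-toPaths {ups} {los} v = rowAt-mkChain f N (sidesRow los) _ _ _ _

  lower upper : Paths → ℕ → ℕ → Side
  lower c r = loSide (f r) (row c r) (row c (suc r))
  upper c zero i = none
  upper c (suc r) i = upSide (f r) (row c r) (row c (suc r)) i

  row-step : ∀ c r → r < N → Step (f r) (row c r) (row c (suc r))
  row-step c = rowAt-step f N (replicate (h 0) false) c

  row-length : ∀ c r → r ≤ N → length (row c r) ≡ h r
  row-length c zero p = length-replicate (h 0)
  row-length c (suc r) p = determined (f r) (row-length c r (<⇒≤ p)) (Step-length (f r) _ _ (row-step c r p)) (h-step r p)
    where
    determined : ∀ x {m n m′ n′} → m ≡ m′ → Height x m n → Height x m′ n′ → n ≡ n′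
    determined ex refl refl refl = refl
    determined co refl e e′ = suc-injective (trans (sym e) e′)

  row-last : ∀ c i → i < h N → get (row c N) i ≡ true
  row-last c i p = subst (λ R → get R i ≡ true) (sym (rowAt-last f N _ c))
    (get-replicate _ true i (subst (i <_) (sym (row-length c N ≤-refl)) p))

  lower-last : ∀ c i → lower c N i ≡ none
  lower-last c i = lemma (row c N) f-last (rowAt-beyond f N (replicate (h 0) false) c)
    where
    lemma : ∀ {x M} S → x ≡ ex → M ≡ [] → loSide x S M i ≡ none
    lemma [] refl refl = refl
    lemma (_ ∷ _) refl refl = refl

  covered-lower : ∀ c r → r ≤ N → ∀ i → i < h r → covered (lower c r i) ≡ signed (f r) (get (row c r) i)
  covered-lower c r p i q with m≤n⇒m<n∨m≡n p
  ... | inj₁ r<N = covered-loSide (f r) _ _ (row-step c r r<N) i (subst (i <_) (sym (row-length c r p)) q)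
  ... | inj₂ refl = trans (cong covered (lower-last c i)) (sym (cong₂ signed f-last (row-last c i q)))

  covered-upper : ∀ c r → r < N → ∀ i → i < h (suc r) → covered (upper c (suc r) i) ≡ signed (f r) (get (row c (suc r)) i)
  covered-upper c r p i q = covered-upSide (f r) _ _ (row-step c r p) i (subst (i <_) (sym (row-length c (suc r) p)) q)

  valid : ∀ c → Valid (upper c) (lower c)
  valid c = record { top = λ _ _ → refl ; bottom = λ i _ → lower-last c i ; joint = jt ; zig = zg }
    where
    jt : ∀ r → r ≤ N → ∀ i → i < h r → Joint (cut r) (upper c r i) (lower c r i)
    jt zero p i q = subst (λ x → Joint x none (lower c 0 i)) (sym cut-zero)
      (sym (cong not (trans (covered-lower c 0 z≤n i q) (cong₂ signed f-zero (get-replicate (h 0) false i q)))))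
    -- Both sides of the row are read off the same entry of its state, with the sign of the letter
    -- above and that of the letter below.
    jt (suc r) p i q = signed⇒Joint (f r) _ _ _ _ (f-suc r p)
      (trans (cong (signed (f (suc r))) (covered-lower c (suc r) p i q))
      (trans (signed-involutive (f (suc r)) _)
      (trans (sym (signed-involutive (f r) _)) (cong (signed (f r)) (sym (covered-upper c r p i q))))))
    zg : ∀ r → r < N → ZigAt (f r) (h r) (h (suc r)) (lower c r) (upper c (suc r))
    zg r p = subst₂ (λ m n → ZigAt (f r) m n (lower c r) (upper c (suc r)))
      (row-length c r (<⇒≤ p)) (row-length c (suc r) p) (Step⇒ZigAt (f r) _ _ (row-step c r p))

  -- The states of `toPaths` are computed from the lower sides alone, so agreement there suffices.
  toPaths-unique : ∀ {ups los} (v : Valid ups los) c →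
    (∀ r → r ≤ N → ∀ i → i < h r → los r i ≡ lower c r i) → toPaths v ≡ c
  toPaths-unique {ups} {los} v c e = Chain-ext f N _ (toPaths v) c λ r p → trans (row-toPaths v r p)
    (trans (tab-cong (h r) λ i q → trans (cong (λ s → signed (f r) (covered s)) (e r p i q))
             (trans (cong (signed (f r)) (covered-lower c r p i q)) (signed-involutive (f r) _)))
           (tab-get (h r) (row c r) (row-length c r p)))

  lower-toPaths : ∀ {ups los} (v : Valid ups los) r → r ≤ N → ∀ i → i < h r → lower (toPaths v) r i ≡ los r i
  lower-toPaths {ups} {los} v r p i q with m≤n⇒m<n∨m≡n p
  ... | inj₂ refl = trans (lower-last (toPaths v) i) (sym (bottom v i q))
  ... | inj₁ r<N rewrite row-toPaths v r p | row-toPaths v (suc r) r<N | sidesRow-suc v r r<N =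
    loSide-bits (f r) (h-step r r<N) (zig v r r<N) i q

  upper-toPaths : ∀ {ups los} (v : Valid ups los) r → r ≤ N → ∀ i → i < h r → upper (toPaths v) r i ≡ ups r i
  upper-toPaths v zero p i q = sym (top v i q)
  upper-toPaths {ups} {los} v (suc r) p i q rewrite row-toPaths v r (<⇒≤ p) | row-toPaths v (suc r) p | sidesRow-suc v r p =
    upSide-bits (f r) (h-step r p) (zig v r p) i q

-- Tilings as direction functions on cells

concatMap-unique : ∀ {A : Set} (g : ℕ → List A) n → (∀ i → Unique (g i)) →
  (∀ {i j x} → x ∈ g i → x ∈ g j → i ≡ j) → Unique (concatMap g (upTo n))
concatMap-unique g n u d = Unique.concat⁺
  (All.map⁺ (All.applyUpTo⁺₂ _ n λ i → u i))
  (AllPairs.map⁺ (AllPairs.applyUpTo⁺₁ _ n λ i<j _ (p , q) → <⇒≢ i<j (d p q)))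

pieceEq-sound : ∀ p q → T (pieceEq p q) → p ≡ q
pieceEq-sound sq sq _ = refl
pieceEq-sound up up _ = refl
pieceEq-sound down down _ = refl

pieceEq-refl : ∀ p → T (pieceEq p p)
pieceEq-refl sq = tt
pieceEq-refl up = tt
pieceEq-refl down = tt

cellEq-sound : ∀ c c′ → T (cellEq c c′) → c ≡ c′
cellEq-sound (cell r x p) (cell r′ x′ p′) e
  with er , e′ ← Equivalence.to T-∧ e
  with ec , ep ← Equivalence.to T-∧ e′
  with refl ← ≡ᵇ⇒≡ r r′ er | refl ← toWitness {a? = x ℤ.≟ x′} ec | refl ← pieceEq-sound p p′ ep = refl

cellEq-refl : ∀ c → T (cellEq c c)
cellEq-refl (cell r x p) =
  Equivalence.from T-∧ (≡⇒≡ᵇ r r refl , Equivalence.from T-∧ (fromWitness {a? = x ℤ.≟ x} refl , pieceEq-refl p))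

dirEq-sound : ∀ d e → T (dirEq d e) → d ≡ e
dirEq-sound dE dE _ = refl
dirEq-sound dW dW _ = refl
dirEq-sound dN dN _ = refl
dirEq-sound dS dS _ = refl
dirEq-sound dG dG _ = refl

dirEq-refl : ∀ d → T (dirEq d d)
dirEq-refl dE = tt
dirEq-refl dW = tt
dirEq-refl dN = tt
dirEq-refl dS = tt
dirEq-refl dG = tt

-- The value `dG` off the list is arbitrary: directions are only compared at cells of the list.
at : (cs : List Cell) → Vec Dir (length cs) → Cell → Dir
at [] v x = dG
at (c ∷ cs) (d ∷ v) x = if cellEq c x then d else at cs v x

at-lookup : (cs : List Cell) → Unique cs → ∀ v i → at cs v (lookup cs i) ≡ V.lookup v i
at-lookup (c ∷ cs) u (d ∷ v) zero with cellEq c c | cellEq-refl c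
... | true | _ = refl
at-lookup (c ∷ cs) (n ∷ u) (d ∷ v) (suc i) with cellEq c (lookup cs i) | cellEq-sound c (lookup cs i)
... | true | e = contradiction (e tt) (All.lookup n (∈-lookup i))
... | false | _ = at-lookup cs u v i

offset-injective : ∀ z {i j} → z ℤ.+ + i ≡ z ℤ.+ + j → i ≡ j
offset-injective z e = ℤ.+-injective (∙-cancelˡ z _ _ e)

module Tilings (a : ℕ) (ds : List ℕ) where
  open Region a ds

  -- The tiling condition without indices into the list of cells, so that partners can be handled by
  -- their coordinates.
  Good : (Cell → Dir) → Set
  Good g = ∀ c → c ∈ cells → Σ Cell λ c′ → neighbor c (g c) ≡ just c′ × c′ ∈ cells × g c′ ≡ opp (g c)

  ∈-pieces : ∀ {r x c} → c ∈ piecesOf r x → Cell.row c ≡ r × Cell.col c ≡ x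
  ∈-pieces {r} p with isCut r
  ∈-pieces {r} (here refl) | true = refl , refl
  ∈-pieces {r} (there (here refl)) | true = refl , refl
  ∈-pieces {r} (here refl) | false = refl , refl

  pieces-unique : ∀ r x → Unique (piecesOf r x)
  pieces-unique r x with isCut r
  ... | true = ((λ ()) ∷ []) ∷ [] ∷ []
  ... | false = [] ∷ []

  rowCells : ℕ → List Cell
  rowCells r = concatMap (λ i → piecesOf r (proj₁ (Q r) ℤ.+ + i)) (upTo (rowLen r))

  ∈-rowCells : ∀ {r c} → c ∈ rowCells r → Cell.row c ≡ r
  ∈-rowCells {r} p with find (∈-concatMap⁻ (λ i → piecesOf r (proj₁ (Q r) ℤ.+ + i)) {upTo (rowLen r)} p)
  ... | i , _ , q = proj₁ (∈-pieces {r} q)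

  cells-unique : Unique cells
  cells-unique = concatMap-unique rowCells (suc N)
    (λ r → concatMap-unique (λ i → piecesOf r (proj₁ (Q r) ℤ.+ + i)) (rowLen r) (λ i → pieces-unique r _)
      λ {i} {j} p q → offset-injective (proj₁ (Q r)) (trans (sym (proj₂ (∈-pieces {r} p))) (proj₂ (∈-pieces {r} q))))
    λ p q → trans (sym (∈-rowCells p)) (∈-rowCells q)

  direction : Vec Dir nCells → Cell → Dir
  direction = at cells

  -- The predicate checked by isTiling is local to it and has no name; unification recovers it.
  okAt : ∀ v → Σ (Fin nCells → Bool) λ ok → isTiling v ≡ all ok (allFin nCells)
  okAt v = _ , refl

  Ok : Vec Dir nCells → Fin nCells → Set
  Ok v i = Σ Cell λ c′ → neighbor (lookup cells i) (V.lookup v i) ≡ just c′ ×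
    Σ (Fin nCells) λ j → lookup cells j ≡ c′ × V.lookup v j ≡ opp (V.lookup v i)

  okAt-sound : ∀ v i → T (proj₁ (okAt v) i) → Ok v i
  okAt-sound v i t with neighbor (lookup cells i) (V.lookup v i)
  ... | just c′ with Any.satisfied (Any.any⁻ _ (allFin nCells) t)
  ... | j , e with Equivalence.to T-∧ e
  ... | e₁ , e₂ = c′ , refl , j , cellEq-sound _ _ e₁ , dirEq-sound _ _ e₂

  okAt-complete : ∀ v i → Ok v i → T (proj₁ (okAt v) i)
  okAt-complete v i (c′ , e , j , e₁ , e₂) with neighbor (lookup cells i) (V.lookup v i)
  okAt-complete v i (c′ , refl , j , refl , e₂) | just _ = Any.any⁺ _ (lose (∈-allFin j)
    (Equivalence.from T-∧ (cellEq-refl (lookup cells j) , subst (λ d → T (dirEq (V.lookup v j) d)) e₂ (dirEq-refl (V.lookup v j)))))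

  direction-lookup : ∀ v i → direction v (lookup cells i) ≡ V.lookup v i
  direction-lookup = at-lookup cells cells-unique

  tiling⇒good : ∀ v → T (isTiling v) → Good (direction v)
  tiling⇒good v t c c∈ rewrite Any.lookup-index c∈
    with Any.index c∈
  ... | i with okAt-sound v i (All.lookup (All.all⁺ (proj₁ (okAt v)) (allFin nCells) t) (∈-allFin i))
  ... | c′ , e , j , refl , q =
    c′ , trans (cong (neighbor (lookup cells i)) (direction-lookup v i)) e , ∈-lookup j ,
    trans (direction-lookup v j) (trans q (cong opp (sym (direction-lookup v i))))

  record-directions : (Cell → Dir) → Vec Dir nCells
  record-directions g = V.tabulate (λ i → g (lookup cells i))

  good⇒tiling : ∀ g → Good g → T (isTiling (record-directions g))
  good⇒tiling g good = All.all⁻ (proj₁ (okAt (record-directions g))) (All.tabulate {xs = allFin nCells} λ {i} _ → okAt-complete (record-directions g) i (ok i))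
    where
    ok : ∀ i → Ok (record-directions g) i
    ok i with good (lookup cells i) (∈-lookup i)
    ... | c′ , e , c′∈ , q = c′ , trans (cong (neighbor (lookup cells i)) (lookup∘tabulate _ i)) e ,
      Any.index c′∈ , sym (Any.lookup-index c′∈) ,
      trans (lookup∘tabulate _ (Any.index c′∈)) (trans (cong g (sym (Any.lookup-index c′∈)))
        (trans q (cong opp (sym (lookup∘tabulate (λ i → g (lookup cells i)) i)))))

  direction-record : ∀ g c → c ∈ cells → direction (record-directions g) c ≡ g c
  direction-record g c c∈ = subst (λ c → direction (record-directions g) c ≡ g c) (sym (Any.lookup-index c∈))
    (trans (direction-lookup (record-directions g) (Any.index c∈)) (lookup∘tabulate _ (Any.index c∈)))

  record-direction : ∀ g v → (∀ c → c ∈ cells → g c ≡ direction v c) → record-directions g ≡ v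
  record-direction g v e = trans
    (tabulate-cong λ i → trans (e (lookup cells i) (∈-lookup i)) (direction-lookup v i))
    (tabulate∘lookup v)

-- Regular cells counted along a word

#ex : List Letter → ℕ
#ex [] = 0
#ex (ex ∷ w) = suc (#ex w)
#ex (co ∷ w) = #ex w

-- The number of regular cells below a row of length n.
area : ℕ → List Letter → ℕ
area n [] = 0
area n (ex ∷ w) = suc n + area (suc n) w
area n (co ∷ w) = area (n ∸ 1) w

sumAfter : ℕ → ℕ → ℕ
sumAfter e zero = 0
sumAfter e (suc k) = suc e + sumAfter (suc e) k

sumAfter-double : ∀ e k → sumAfter e k * 2 ≡ k * suc k + 2 * e * k
sumAfter-double e zero = sym (*-zeroʳ (2 * e))
sumAfter-double e (suc k) = trans (*-distribʳ-+ 2 (suc e) (sumAfter (suc e) k))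
  (trans (cong (λ z → (suc e * 2) + z) (sumAfter-double (suc e) k)) (lemma e k))
  where
  lemma : ∀ e k → suc e * 2 + (k * suc k + 2 * suc e * k) ≡ suc k * suc (suc k) + 2 * e * suc k
  lemma = solve-∀

sumAfter-triangular : ∀ k → sumAfter 0 k ≡ triangular k
sumAfter-triangular k = trans (sym (m*n/n≡m (sumAfter 0 k) 2))
  (cong (_/ 2) (trans (sumAfter-double 0 k) (+-identityʳ (k * suc k))))

-- With `e` letters `ex` already read, the row length is `e` plus the number of letters `co` to
-- come. Hence the j-th `ex` contributes j, which adds up to a triangular number, plus the letters
-- `co` behind it, which are its inversions. The term `e * #co w` accounts for the inversions of the
-- `e` letters in front.
area-inversions : ∀ e w → area (e + #co w) w + e * #co w ≡ sumAfter e (#ex w) + inversions e w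
area-inversions e [] = *-zeroʳ e
area-inversions e (ex ∷ w) = trans (lemma e (#co w) (area (suc e + #co w) w))
  (trans (cong (λ z → suc e + z) (area-inversions (suc e) w)) (sym (+-assoc (suc e) (sumAfter (suc e) (#ex w)) _)))
  where
  lemma : ∀ e c x → suc (e + c) + x + e * c ≡ suc e + (x + suc e * c)
  lemma = solve-∀
area-inversions e (co ∷ w) rewrite +-suc e (#co w) = trans (lemma e (#co w) (area (e + #co w) w))
  (trans (cong (_+ e) (area-inversions e w)) (lemma′ e (sumAfter e (#ex w)) (inversions e w)))
  where
  lemma : ∀ e c x → x + e * suc c ≡ x + e * c + e
  lemma = solve-∀
  lemma′ : ∀ e x y → x + y + e ≡ x + (e + y)
  lemma′ = solve-∀

exCount coCount : Letter → ℕ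
exCount ex = 1
exCount co = 0
coCount ex = 0
coCount co = 1

#ex-word : ∀ f k → #ex (word f (suc k)) ≡ exCount (f k) + #ex (word f k)
#ex-word f zero with f 0
... | ex = refl
... | co = refl
#ex-word f (suc k) with f 0
... | ex = trans (cong suc (#ex-word (λ j → f (suc j)) k)) (sym (+-suc (exCount (f (suc k))) _))
... | co = #ex-word (λ j → f (suc j)) k

#co-word : ∀ f k → #co (word f (suc k)) ≡ coCount (f k) + #co (word f k)
#co-word f zero with f 0
... | ex = refl
... | co = refl
#co-word f (suc k) with f 0
... | co = trans (cong suc (#co-word (λ j → f (suc j)) k)) (sym (+-suc (coCount (f (suc k))) _))
... | ex = #co-word (λ j → f (suc j)) k

sumTo : ℕ → (ℕ → ℕ) → ℕ
sumTo zero F = 0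
sumTo (suc n) F = F 0 + sumTo n (λ i → F (suc i))

sumTo-cong : ∀ n {F G} → (∀ i → i < n → F i ≡ G i) → sumTo n F ≡ sumTo n G
sumTo-cong zero e = refl
sumTo-cong (suc n) e = cong₂ _+_ (e 0 (s≤s z≤n)) (sumTo-cong n λ i p → e (suc i) (s≤s p))

sumTo-const : ∀ n c → sumTo n (λ _ → c) ≡ n * c
sumTo-const zero c = refl
sumTo-const (suc n) c = cong (λ z → c + z) (sumTo-const n c)

sumTo-area : ∀ k f (h : ℕ → ℕ) → (∀ r → r < k → Height (f r) (h r) (h (suc r))) →
  sumTo k (λ r → h (suc r) * exCount (f r)) ≡ area (h 0) (word f k)
sumTo-area zero f h hs = refl
sumTo-area (suc k) f h hs with f 0 | hs 0 (s≤s z≤n) | sumTo-area k (λ r → f (suc r)) (λ r → h (suc r)) (λ r p → hs (suc r) (s≤s p))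
... | ex | e | ih = cong₂ _+_ (trans (*-identityʳ (h 1)) e) (trans ih (cong (λ n → area n (word (λ r → f (suc r)) k)) e))
... | co | e | ih = trans (cong (_+ sumTo k (λ r → h (suc (suc r)) * exCount (f (suc r)))) (*-zeroʳ (h 1)))
  (trans ih (cong (λ n → area n (word (λ r → f (suc r)) k)) (sym (cong (_∸ 1) e))))

bit : Bool → ℕ
bit b = if b then 1 else 0

module _ {A : Set} (p : A → Bool) where

  count : List A → ℕ
  count xs = length (filterᵇ p xs)

  count-∷ : ∀ x xs → count (x ∷ xs) ≡ bit (p x) + count xs
  count-∷ x xs with p x
  ... | true = refl
  ... | false = refl

  count-++ : ∀ xs ys → count (xs ++ ys) ≡ count xs + count ys
  count-++ [] ys = refl
  count-++ (x ∷ xs) ys with p x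
  ... | true = cong suc (count-++ xs ys)
  ... | false = count-++ xs ys

  count-concatMap : ∀ (g : ℕ → List A) (φ : ℕ → ℕ) n →
    count (concatMap g (applyUpTo φ n)) ≡ sumTo n (λ i → count (g (φ i)))
  count-concatMap g φ zero = refl
  count-concatMap g φ (suc n) = trans (count-++ (g (φ 0)) _) (cong (λ z → count (g (φ 0)) + z) (count-concatMap g (λ i → φ (suc i)) n))

-- Parity of levels and positions of the drawn-in diagonals

odd : ℕ → Bool
odd zero = false
odd (suc n) = not (odd n)

odd-% : ∀ n → ((n % 2) ≡ᵇ 0) ≡ not (odd n)
odd-% zero = refl
odd-% (suc zero) = refl
odd-% (suc (suc n)) = trans (odd-% n) (cong not (sym (not-involutive (odd n))))

Sorted : List ℕ → Set
Sorted = AllPairs _<_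

<ᵇ-true : ∀ {m n} → m < n → (m <ᵇ n) ≡ true
<ᵇ-true {m} {n} p with m <ᵇ n | <⇒<ᵇ p
... | true | _ = refl

<ᵇ-false : ∀ {m n} → n ≤ m → (m <ᵇ n) ≡ false
<ᵇ-false {m} {n} p with m <ᵇ n | <ᵇ⇒< m n
... | false | _ = refl
... | true | q = contradiction (q _) (≤⇒≯ p)

≡ᵇ-false : ∀ {m n} → m ≢ n → (m ≡ᵇ n) ≡ false
≡ᵇ-false {m} {n} p with m ≡ᵇ n | ≡ᵇ⇒≡ m n
... | false | _ = refl
... | true | q = contradiction (q _) p

≡ᵇ-refl : ∀ n → (n ≡ᵇ n) ≡ true
≡ᵇ-refl zero = refl
≡ᵇ-refl (suc n) = ≡ᵇ-refl n

any-none : ∀ r l → All (_≢ r) l → any (λ t → t ≡ᵇ r) l ≡ false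
any-none r [] [] = refl
any-none r (t ∷ l) (p ∷ ps) rewrite ≡ᵇ-false p = any-none r l ps

count-none : ∀ r l → All (r ≤_) l → count (λ t → t <ᵇ r) l ≡ 0
count-none r [] [] = refl
count-none r (t ∷ l) (p ∷ ps) rewrite <ᵇ-false p = count-none r l ps

-- Strict sorting makes `r` occur at most once, so the test by `any` measures the exact increase.
count-suc : ∀ r l → Sorted l →
  count (λ t → t <ᵇ suc r) l ≡ count (λ t → t <ᵇ r) l + bit (any (λ t → t ≡ᵇ r) l)
count-suc r [] s = refl
count-suc r (t ∷ l) (t< ∷ s) with <-cmp t r
... | tri< p q _ rewrite <ᵇ-true (m≤n⇒m≤1+n p) | <ᵇ-true p | ≡ᵇ-false q = cong suc (count-suc r l s)
... | tri≈ _ refl _ rewrite <ᵇ-true (n<1+n r) | <ᵇ-false (≤-refl {r}) | ≡ᵇ-refl r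
  | count-none (suc r) l t< | count-none r l (All.map <⇒≤ t<) = refl
... | tri> _ q p rewrite <ᵇ-false p | <ᵇ-false (<⇒≤ p) | ≡ᵇ-false q
  | count-none (suc r) l (All.map (<-trans p) t<) | count-none r l (All.map (λ x → <⇒≤ (<-trans p x)) t<)
  | any-none r l (All.map (λ x → >⇒≢ (<-trans p x)) t<) = refl

drawn-above : ∀ acc ds → All (1 ≤_) ds → All (acc <_) (drawnFrom acc ds)
drawn-above acc [] [] = []
drawn-above acc (d ∷ []) _ = []
drawn-above acc (d ∷ e ∷ ds) (p ∷ ps) =
  m<m+n acc p ∷ All.map (<-trans (m<m+n acc p)) (drawn-above (acc + d) (e ∷ ds) ps)

drawn-below : ∀ acc ds → All (1 ≤_) ds → All (_< acc + sum ds) (drawnFrom acc ds)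
drawn-below acc [] [] = []
drawn-below acc (d ∷ []) _ = []
drawn-below acc (d ∷ e ∷ ds) (p ∷ q ∷ ps) =
  subst (λ n → All (_< n) (drawnFrom acc (d ∷ e ∷ ds))) (+-assoc acc d (sum (e ∷ ds)))
    (m<m+n (acc + d) (≤-trans q (m≤m+n e (sum ds))) ∷ drawn-below (acc + d) (e ∷ ds) (q ∷ ps))

drawn-sorted : ∀ acc ds → All (1 ≤_) ds → Sorted (drawnFrom acc ds)
drawn-sorted acc [] [] = []
drawn-sorted acc (d ∷ []) _ = []
drawn-sorted acc (d ∷ e ∷ ds) (p ∷ ps) = drawn-above (acc + d) (e ∷ ds) ps ∷ drawn-sorted (acc + d) (e ∷ ds) ps

-- Boundary coordinates, row lengths and colours

letterOf : Bool → Letter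
letterOf true = co
letterOf false = ex

letterOf-not : ∀ b → letterOf (not b) ≡ flip (letterOf b)
letterOf-not true = refl
letterOf-not false = refl

module Geometry (a : ℕ) (ds : List ℕ) (pos-ds : All (1 ≤_) ds) where
  open Region a ds
  open Tilings a ds using (rowCells)

  cut-zero : isCut 0 ≡ false
  cut-zero = any-none 0 drawn (All.map >⇒≢ (drawn-above 0 ds pos-ds))

  cut-last : isCut N ≡ false
  cut-last = any-none N drawn (All.map <⇒≢ (drawn-below 0 ds pos-ds))

  cntAbove-suc : ∀ r → cntAbove (suc r) ≡ cntAbove r + bit (isCut r)
  cntAbove-suc r = count-suc r drawn (drawn-sorted 0 ds pos-ds)

  isBlack-odd : ∀ c → isBlack c ≡ odd (level c)
  isBlack-odd c with (level c % 2) ≡ᵇ 0 | odd-% (level c)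
  ... | true | e = trans (cong not e) (not-involutive (odd (level c)))
  ... | false | e = trans (cong not e) (not-involutive (odd (level c)))

  upPiece loPiece : ℕ → Piece
  upPiece = westPiece
  loPiece = eastPiece

  upLevel loLevel : ℕ → ℕ
  upLevel r = r + cntAbove r
  loLevel r = upLevel r + bit (isCut r)

  level-lo : ∀ r x → level (cell r x (loPiece r)) ≡ loLevel r
  level-lo r x with isCut r
  ... | true = refl
  ... | false = refl

  upLevel-suc : ∀ r → upLevel (suc r) ≡ suc (loLevel r)
  upLevel-suc r = cong suc (trans (cong (λ z → r + z) (cntAbove-suc r)) (sym (+-assoc r (cntAbove r) _)))

  letter : ℕ → Letter
  letter r = letterOf (odd (loLevel r))

  letter-suc : ∀ r → letter (suc r) ≡ (if isCut (suc r) then letter r else flip (letter r))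
  letter-suc r = trans (cong (λ n → letterOf (odd (n + bit (isCut (suc r))))) (upLevel-suc r)) (lemma (loLevel r) (isCut (suc r)))
    where
    lemma : ∀ n c → letterOf (odd (suc n + bit c)) ≡ (if c then letterOf (odd n) else flip (letterOf (odd n)))
    lemma n true rewrite +-comm n 1 = cong letterOf (not-involutive (odd n))
    lemma n false rewrite +-identityʳ n = letterOf-not (odd n)

  letter-zero : letter 0 ≡ ex
  letter-zero rewrite cut-zero | count-none 0 drawn (All.map (λ _ → z≤n) (drawn-above 0 ds pos-ds)) = refl

  letter-last : (∀ x → color (cell N x sq) ≡ white) → letter N ≡ ex
  letter-last wh = cong letterOf (trans (cong (λ c → odd (upLevel N + bit c)) cut-last) (even (cell N (+ 0) sq) (wh (+ 0))))
    where
    even : ∀ c → color c ≡ white → odd (level c) ≡ false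
    even c e with (level c % 2) ≡ᵇ 0 | odd-% (level c)
    ... | true | q = trans (sym (not-involutive _)) (cong not (sym q))

  upLevel-zero : upLevel 0 ≡ 0
  upLevel-zero = count-none 0 drawn (All.map (λ _ → z≤n) (drawn-above 0 ds pos-ds))

  regular-odd : ∀ r x p → pieceEq p down ≡ false → isRegular (cell r x p) ≡ odd (upLevel r)
  regular-odd r x up refl = trans (∧-identityʳ (isBlack (cell r x up))) (trans (isBlack-odd (cell r x up)) (cong odd (+-identityʳ (upLevel r))))
  regular-odd r x sq refl = trans (∧-identityʳ (isBlack (cell r x sq))) (trans (isBlack-odd (cell r x sq)) (cong odd (+-identityʳ (upLevel r))))

  -- Only the upper piece of a square can be regular, and the upper pieces of a row share one level,
  -- so a row contributes all of them or none.
  pieces-regular : ∀ r x → count isRegular (piecesOf r x) ≡ bit (odd (upLevel r))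
  pieces-regular r x with isCut r
  ... | true = trans (count-∷ isRegular (cell r x up) (cell r x down ∷ []))
    (trans (cong₂ _+_ (cong bit (regular-odd r x up refl))
      (trans (count-∷ isRegular (cell r x down) []) (cong (λ b → bit b + 0) (∧-zeroʳ (isBlack (cell r x down))))))
    (+-identityʳ (bit (odd (upLevel r)))))
  ... | false = trans (count-∷ isRegular (cell r x sq) [])
    (trans (+-identityʳ (bit (isRegular (cell r x sq)))) (cong bit (regular-odd r x sq refl)))

  row-regular : ∀ r → count isRegular (rowCells r) ≡ rowLen r * bit (odd (upLevel r))
  row-regular r = trans (count-concatMap isRegular (λ i → piecesOf r (proj₁ (Q r) ℤ.+ + i)) (λ i → i) (rowLen r))
    (trans (sumTo-cong (rowLen r) λ i _ → pieces-regular r (proj₁ (Q r) ℤ.+ + i)) (sumTo-const (rowLen r) (bit (odd (upLevel r)))))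

  X Y : ℕ → ℕ
  X r = #ex (word letter r)
  Y r = #co (word letter r)

  -- The boundary steps south exactly when the lower cells of the row are black, which is the letter
  -- `co`, and east at `ex`.
  P-coordinates : ∀ r → P r ≡ (+ X r , ℤ.- (+ Y r))
  P-coordinates zero = refl
  P-coordinates (suc r) with P r | P-coordinates r
  ... | _ | refl rewrite isBlack-odd (cell r (+ X r - + 1) (eastPiece r)) | level-lo r (+ X r - + 1)
    | #ex-word letter r | #co-word letter r with odd (loLevel r)
  ... | true = cong (+ X r ,_) (lemma (Y r))
    where
    lemma : ∀ n → ℤ.- (+ n) - + 1 ≡ ℤ.- (+ suc n)
    lemma zero = refl
    lemma (suc n) = cong ℤ.-[1+_] (cong suc (+-identityʳ n))
  ... | false = cong (_, ℤ.- (+ Y r)) (cong +_ (+-comm (X r) 1))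

  xQ : ℕ → ℤ
  xQ r = proj₁ (Q r)

  xQ-coordinate : ∀ r → xQ r ≡ + Y r - + a
  xQ-coordinate r rewrite P-coordinates r | ℤ.neg-involutive (+ Y r) = ℤ.+-comm (ℤ.- (+ a)) (+ Y r)

  pos : ℕ → ℕ → ℤ
  pos r i = xQ r ℤ.+ + i

  pos-injective : ∀ r {i j} → pos r i ≡ pos r j → i ≡ j
  pos-injective r = offset-injective (xQ r)

  pos-suc : ∀ r i → pos r i ℤ.+ + 1 ≡ pos r (suc i)
  pos-suc r i = trans (ℤ.+-assoc (xQ r) (+ i) (+ 1)) (cong (λ n → xQ r ℤ.+ + n) (+-comm i 1))

  index : ∀ r i → ∣ pos r i - xQ r ∣ ≡ i
  index r i = cong ∣_∣ (trans (cong (_- xQ r) (ℤ.+-comm (xQ r) (+ i)))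
    (trans (ℤ.+-assoc (+ i) (xQ r) (ℤ.- xQ r)) (trans (cong (λ z → + i ℤ.+ z) (ℤ.+-inverseʳ (xQ r))) (ℤ.+-identityʳ (+ i)))))

  xQ-suc : ∀ r → xQ (suc r) ≡ xQ r ℤ.+ + coCount (letter r)
  xQ-suc r = trans (xQ-coordinate (suc r)) (trans (cong (λ n → + n - + a) (#co-word letter r))
    (trans (lemma (+ coCount (letter r)) (+ Y r) (ℤ.- (+ a))) (cong (ℤ._+ + coCount (letter r)) (sym (xQ-coordinate r)))))
    where
    lemma : ∀ c y z → c ℤ.+ y ℤ.+ z ≡ y ℤ.+ z ℤ.+ c
    lemma c y z = trans (ℤ.+-assoc c y z) (ℤ.+-comm c (y ℤ.+ z))

  pos-next : ∀ r i → pos (suc r) i ≡ pos r (coCount (letter r) + i)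
  pos-next r i = trans (cong (ℤ._+ + i) (xQ-suc r)) (ℤ.+-assoc (xQ r) (+ coCount (letter r)) (+ i))

  Y-mono : ∀ r k → r ≤ k → Y r ≤ Y k
  Y-mono zero zero z≤n = ≤-refl
  Y-mono r (suc k) p with m≤n⇒m<n∨m≡n p
  ... | inj₂ refl = ≤-refl
  ... | inj₁ (s≤s q) = ≤-trans (Y-mono r k q) (subst (Y k ≤_) (sym (#co-word letter k)) (m≤n+m (Y k) _))

  -- The difference of the abscissas of `P r` and `Q r`, since `Q r` has abscissa `Y r - a`; the
  -- truncated subtraction is exact once `Y r ≤ a`.
  height : ℕ → ℕ
  height r = X r + (a ∸ Y r)

  module Balanced (balance : proj₂ D ≡ proj₂ B) where

    -- D has ordinate `- a` and B has ordinate `- Y N`. Monotonicity of `Y` then bounds every `Y r`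
    -- by `a`, so all row lengths are genuine.
    Y-last : Y N ≡ a
    Y-last = sym (ℤ.+-injective (ℤ.neg-injective (trans (sym (ℤ.+-identityʳ (ℤ.- (+ a)))) (trans balance (cong proj₂ (P-coordinates N))))))

    Y≤a : ∀ r → r ≤ N → Y r ≤ a
    Y≤a r p = subst (Y r ≤_) Y-last (Y-mono r N p)

    height-step : ∀ r → r < N → Height (letter r) (height r) (height (suc r))
    height-step r p with Y≤a (suc r) p
    ... | q rewrite #ex-word letter r | #co-word letter r with letter r
    ... | ex = refl
    ... | co = trans (cong (λ z → X r + z) (sym (suc-∸ q))) (+-suc (X r) _)
      where
      suc-∸ : ∀ {m n} → m < n → suc (n ∸ suc m) ≡ n ∸ m
      suc-∸ (s≤s q) = sym (+-∸-assoc 1 q)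

    diff : ∀ r → r ≤ N → proj₁ (P r) - xQ r ≡ + height r
    diff r p = trans (cong₂ _-_ (cong proj₁ (P-coordinates r)) (trans (xQ-coordinate r) (ℤ.m-n≡m⊖n (Y r) a)))
      (trans (cong (λ z → + X r ℤ.+ z) (sym (ℤ.⊖-swap a (Y r)))) (cong (λ z → + X r ℤ.+ z) (ℤ.⊖-≥ (Y≤a r p))))

    rowLen-height : ∀ r → r ≤ N → rowLen r ≡ height r
    rowLen-height r p with xQ r ℤ.≤? proj₁ (P r)
    ... | yes _ = cong ∣_∣ (diff r p)
    ... | no q = contradiction (ℤ.0≤i-j⇒j≤i (subst (+ 0 ℤ.≤_) (sym (diff r p)) (ℤ.+≤+ z≤n))) q

    width-X : width ≡ X N
    width-X = trans (cong ∣_∣ (diff N ≤-refl))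
      (trans (cong (λ y → X N + (a ∸ y)) Y-last) (trans (cong (λ z → X N + z) (n∸n≡0 a)) (+-identityʳ (X N))))

    -- Row 0 consists of white squares and contributes nothing. The upper cells of a later row have
    -- the colour opposite to the lower cells just above, so the row contributes its full length
    -- exactly after a letter `ex`.
    nRegular-formula : nRegular ≡ triangular width + inversions 0 (word letter N)
    nRegular-formula = trans (count-concatMap isRegular rowCells (λ r → r) (suc N))
      (trans (cong₂ _+_
        (trans (row-regular 0) (trans (cong (λ n → rowLen 0 * bit (odd n)) upLevel-zero) (*-zeroʳ (rowLen 0))))
        (trans (sumTo-cong N λ r p → trans (row-regular (suc r))
            (cong₂ _*_ (rowLen-height (suc r) p) (trans (cong (λ n → bit (odd n)) (upLevel-suc r)) (bit-letter (odd (loLevel r))))))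
          (sumTo-area N letter height height-step)))
      (trans (sym (trans (+-identityʳ (area (Y N) (word letter N))) (cong (λ n → area n (word letter N)) Y-last)))
      (trans (area-inversions 0 (word letter N))
        (cong (_+ inversions 0 (word letter N)) (trans (sumAfter-triangular (X N)) (cong triangular (sym width-X)))))))
      where
      bit-letter : ∀ b → bit (not b) ≡ exCount (letterOf b)
      bit-letter true = refl
      bit-letter false = refl

-- Directions of edges versus sides in a path

-- Columns are counted from the southwestern boundary, so west and south are
-- the left neighbours in a zigzag, and north and east the right ones.
sideUp sideLo : Dir → Side
sideUp dW = left
sideUp dN = right
sideUp _ = none
sideLo dS = left
sideLo dE = right
sideLo _ = none

dirUp dirLo : Side → Dir
dirUp left = dW
dirUp right = dN
dirUp none = dG
dirLo left = dS
dirLo right = dE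
dirLo none = dG

-- The precedence of the upper side for a square never decides anything under `Joint`, where only
-- one of the two sides is covered.
dirAt : Piece → Side → Side → Dir
dirAt sq none l = dirLo l
dirAt sq u l = dirUp u
dirAt up u l = dirUp u
dirAt down u l = dirLo l

upOf loOf : Bool → Piece
upOf b = if b then up else sq
loOf b = if b then down else sq

dirAt-lo : ∀ b u l → Joint b u l → l ≢ none → dirAt (loOf b) u l ≡ dirLo l
dirAt-lo true u l j n = refl
dirAt-lo false none l j n = refl
dirAt-lo false left none j n = ⊥-elim (n refl)
dirAt-lo false right none j n = ⊥-elim (n refl)

dirAt-up : ∀ b u l → u ≢ none → dirAt (upOf b) u l ≡ dirUp u
dirAt-up true u l n = refl
dirAt-up false none l n = ⊥-elim (n refl)
dirAt-up false left l n = refl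
dirAt-up false right l n = refl

sideLo-dirAt : ∀ b u l → Joint b u l → sideLo (dirAt (loOf b) u l) ≡ l
sideLo-dirAt true u none j = refl
sideLo-dirAt true u left j = refl
sideLo-dirAt true u right j = refl
sideLo-dirAt false none left j = refl
sideLo-dirAt false none right j = refl
sideLo-dirAt false left none j = refl
sideLo-dirAt false right none j = refl

-- `ZigAt` as the geometry presents it: `coCount x` is the shift of columns between consecutive
-- rows, and the bounds say that the partner lies in the region. The end conditions of `ZigAt`
-- follow from these bounds.
record Links (x : Letter) (m n : ℕ) (los ups : ℕ → Side) : Set where
  field
    lo-left  : ∀ i → i < m → los i ≡ left → Σ ℕ λ j → j < n × i ≡ coCount x + j × ups j ≡ right
    lo-right : ∀ i → i < m → los i ≡ right → Σ ℕ λ j → j < n × suc i ≡ coCount x + j × ups j ≡ left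
    up-right : ∀ j → j < n → ups j ≡ right → Σ ℕ λ i → i < m × i ≡ coCount x + j × los i ≡ left
    up-left  : ∀ j → j < n → ups j ≡ left → Σ ℕ λ i → i < m × suc i ≡ coCount x + j × los i ≡ right

open Links

ZigAt⇒Links : ∀ x {m n los ups} → Height x m n → ZigAt x m n los ups → Links x m n los ups
ZigAt⇒Links ex {m} {_} {los} {ups} refl (z , s) = record
  { lo-left  = λ i p e → i , s≤s (<⇒≤ p) , refl , w-left z i p e
  ; lo-right = λ i p e → suc i , s≤s p , refl , w-right z i p e
  ; up-right = λ j p e → let q = inner j p e in j , q , refl , b-right z j q e
  ; up-left  = λ { zero p e → ⊥-elim (s e) ; (suc i) (s≤s p) e → i , p , refl , b-left z i p e } }
  where
  inner : ∀ j → j < suc m → ups j ≡ right → j < m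
  inner j (s≤s p) e with m≤n⇒m<n∨m≡n p
  ... | inj₁ q = q
  ... | inj₂ refl = ⊥-elim (b-last z e)
ZigAt⇒Links co {_} {n} {los} {ups} refl (z , s) = record
  { lo-left  = λ { zero p e → ⊥-elim (s e) ; (suc j) (s≤s p) e → j , p , refl , b-left z j p e }
  ; lo-right = λ i p e → let q = inner i p e in i , q , refl , b-right z i q e
  ; up-right = λ j p e → suc j , s≤s p , refl , w-right z j p e
  ; up-left  = λ j p e → j , s≤s (<⇒≤ p) , refl , w-left z j p e }
  where
  inner : ∀ j → j < suc n → los j ≡ right → j < n
  inner j (s≤s p) e with m≤n⇒m<n∨m≡n p
  ... | inj₁ q = q
  ... | inj₂ refl = ⊥-elim (b-last z e)

Links⇒ZigAt : ∀ x {m n los ups} → Height x m n → Links x m n los ups → ZigAt x m n los ups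
Links⇒ZigAt ex {m} {_} {los} {ups} refl l = record
  { w-left  = wl ; w-right = wr ; b-left = bl ; b-right = br
  ; b-last = λ e → let (i , p , q , _) = up-right l m (n<1+n m) e in <-irrefl q p }
  , λ e → case-⊥ (up-left l 0 (s≤s z≤n) e)
  where
  case-⊥ : (Σ ℕ λ i → i < m × suc i ≡ 0 × los i ≡ right) → _
  case-⊥ (i , _ , () , _)
  wl : ∀ i → i < m → los i ≡ left → ups i ≡ right
  wl i p e with lo-left l i p e
  ... | _ , _ , refl , u = u
  wr : ∀ i → i < m → los i ≡ right → ups (suc i) ≡ left
  wr i p e with lo-right l i p e
  ... | _ , _ , refl , u = u
  bl : ∀ i → i < m → ups (suc i) ≡ left → los i ≡ right
  bl i p e with up-left l (suc i) (s≤s p) e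
  ... | _ , _ , refl , u = u
  br : ∀ i → i < m → ups i ≡ right → los i ≡ left
  br i p e with up-right l i (m≤n⇒m≤1+n p) e
  ... | _ , _ , refl , u = u
Links⇒ZigAt co {_} {n} {los} {ups} refl l = record
  { w-left  = wl ; w-right = wr ; b-left = bl ; b-right = br
  ; b-last = λ e → let (j , p , q , _) = lo-right l n (n<1+n n) e in <-irrefl (sym (suc-injective q)) p }
  , λ e → case-⊥ (lo-left l 0 (s≤s z≤n) e)
  where
  case-⊥ : (Σ ℕ λ j → j < n × 0 ≡ suc j × ups j ≡ right) → _
  case-⊥ (i , _ , () , _)
  wl : ∀ i → i < n → ups i ≡ left → los i ≡ right
  wl i p e with up-left l i p e
  ... | _ , _ , refl , u = u
  wr : ∀ i → i < n → ups i ≡ right → los (suc i) ≡ left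
  wr i p e with up-right l i p e
  ... | _ , _ , refl , u = u
  bl : ∀ i → i < n → los (suc i) ≡ left → ups i ≡ right
  bl i p e with lo-left l (suc i) (s≤s p) e
  ... | _ , _ , refl , u = u
  br : ∀ i → i < n → los i ≡ right → ups i ≡ left
  br i p e with lo-right l i (m≤n⇒m≤1+n p) e
  ... | _ , _ , refl , u = u

minus-plus : ∀ x y → x ℤ.- + 1 ≡ y → x ≡ y ℤ.+ + 1
minus-plus x y refl = sym (trans (ℤ.+-assoc x (ℤ.- (+ 1)) (+ 1)) (ℤ.+-identityʳ x))

plus-minus : ∀ x y → x ≡ y ℤ.+ + 1 → x ℤ.- + 1 ≡ y
plus-minus x y refl = trans (ℤ.+-assoc y (+ 1) (ℤ.- (+ 1))) (ℤ.+-identityʳ y)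

-- The bijection between tilings and chains

module Bridge (a : ℕ) (ds : List ℕ) (pos-ds : All (1 ≤_) ds)
  (wh : ∀ x → Region.color a ds (cell (Region.N a ds) x sq) ≡ white)
  (balance : proj₂ (Region.D a ds) ≡ proj₂ (Region.B a ds)) where

  open Region a ds
  open Geometry a ds pos-ds
  open Balanced balance
  open Tilings a ds
  open Rows N letter height isCut letter-zero (letter-last wh) cut-zero (λ r _ → letter-suc r) height-step
  open Valid

  U L : ℕ → ℕ → Cell
  U r i = cell r (pos r i) (upPiece r)
  L r i = cell r (pos r i) (loPiece r)

  ∈-piecesOf⁻ : ∀ r x {c} → c ∈ piecesOf r x → c ≡ cell r x (upPiece r) ⊎ c ≡ cell r x (loPiece r)
  ∈-piecesOf⁻ r x p with isCut r
  ∈-piecesOf⁻ r x (here e) | true = inj₁ e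
  ∈-piecesOf⁻ r x (there (here e)) | true = inj₂ e
  ∈-piecesOf⁻ r x (here e) | false = inj₁ e

  U∈piecesOf : ∀ r x → cell r x (upPiece r) ∈ piecesOf r x
  U∈piecesOf r x with isCut r
  ... | true = here refl
  ... | false = here refl

  L∈piecesOf : ∀ r x → cell r x (loPiece r) ∈ piecesOf r x
  L∈piecesOf r x with isCut r
  ... | true = there (here refl)
  ... | false = here refl

  ∈-cells⁺ : ∀ {c} r i → r ≤ N → i < height r → c ∈ piecesOf r (pos r i) → c ∈ cells
  ∈-cells⁺ r i p q m = ∈-concatMap⁺ rowCells (lose (∈-upTo⁺ (s≤s p))
    (∈-concatMap⁺ (λ i → piecesOf r (pos r i)) (lose (∈-upTo⁺ (subst (i <_) (sym (rowLen-height r p)) q)) m)))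

  U∈ : ∀ r i → r ≤ N → i < height r → U r i ∈ cells
  U∈ r i p q = ∈-cells⁺ r i p q (U∈piecesOf r (pos r i))

  L∈ : ∀ r i → r ≤ N → i < height r → L r i ∈ cells
  L∈ r i p q = ∈-cells⁺ r i p q (L∈piecesOf r (pos r i))

  data InRegion : Cell → Set where
    upper-cell : ∀ r i → r ≤ N → i < height r → InRegion (U r i)
    lower-cell : ∀ r i → r ≤ N → i < height r → InRegion (L r i)

  ∈-cells⁻ : ∀ {c} → c ∈ cells → InRegion c
  ∈-cells⁻ m with find (∈-concatMap⁻ rowCells {upTo (suc N)} m)
  ... | r , r∈ , m′ with find (∈-concatMap⁻ (λ i → piecesOf r (pos r i)) {upTo (rowLen r)} m′)
  ... | i , i∈ , m″ with ∈-upTo⁻ r∈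
  ... | s≤s p with subst (i <_) (rowLen-height r p) (∈-upTo⁻ i∈) | ∈-piecesOf⁻ r (pos r i) m″
  ... | q | inj₁ refl = upper-cell r i p q
  ... | q | inj₂ refl = lower-cell r i p q

  position : ∀ {r x p} → cell r x p ∈ cells → r ≤ N × Σ ℕ λ i → i < height r × x ≡ pos r i
  position m with ∈-cells⁻ m
  ... | upper-cell r i p q = p , i , q , refl
  ... | lower-cell r i p q = p , i , q , refl

  neighbor-E : ∀ r x → neighbor (cell r x (loPiece r)) dE ≡ just (cell (suc r) (x ℤ.+ + 1) (upPiece (suc r)))
  neighbor-E r x with isCut r
  ... | true = refl
  ... | false = refl

  neighbor-S : ∀ r x → neighbor (cell r x (loPiece r)) dS ≡ just (cell (suc r) x (upPiece (suc r)))
  neighbor-S r x with isCut r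
  ... | true = refl
  ... | false = refl

  neighbor-W : ∀ r x → neighbor (cell (suc r) x (upPiece (suc r))) dW ≡ just (cell r (x - + 1) (loPiece r))
  neighbor-W r x with isCut (suc r)
  ... | true = refl
  ... | false = refl

  neighbor-N : ∀ r x → neighbor (cell (suc r) x (upPiece (suc r))) dN ≡ just (cell r x (loPiece r))
  neighbor-N r x with isCut (suc r)
  ... | true = refl
  ... | false = refl

  neighbor-top : ∀ x d → sideUp d ≢ none → neighbor (cell 0 x (upPiece 0)) d ≡ nothing
  neighbor-top x d n with isCut 0
  neighbor-top x dW n | true = refl
  neighbor-top x dN n | true = refl
  neighbor-top x dW n | false = refl
  neighbor-top x dN n | false = refl
  neighbor-top x dE n | _ = ⊥-elim (n refl)
  neighbor-top x dS n | _ = ⊥-elim (n refl)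
  neighbor-top x dG n | _ = ⊥-elim (n refl)

  data Edgeless : Piece → Dir → Set where
    sq-G : Edgeless sq dG
    up-E : Edgeless up dE
    up-S : Edgeless up dS
    down-W : Edgeless down dW
    down-N : Edgeless down dN

  neighbor-edgeless : ∀ r x {p d} → Edgeless p d → neighbor (cell r x p) d ≡ nothing
  neighbor-edgeless zero x sq-G = refl
  neighbor-edgeless (suc r) x sq-G = refl
  neighbor-edgeless zero x up-E = refl
  neighbor-edgeless (suc r) x up-E = refl
  neighbor-edgeless zero x up-S = refl
  neighbor-edgeless (suc r) x up-S = refl
  neighbor-edgeless zero x down-W = refl
  neighbor-edgeless (suc r) x down-W = refl
  neighbor-edgeless zero x down-N = refl
  neighbor-edgeless (suc r) x down-N = refl

  neighbor-up-G : ∀ r x → neighbor (cell r x up) dG ≡ just (cell r x down)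
  neighbor-up-G zero x = refl
  neighbor-up-G (suc r) x = refl

  neighbor-down-G : ∀ r x → neighbor (cell r x down) dG ≡ just (cell r x up)
  neighbor-down-G zero x = refl
  neighbor-down-G (suc r) x = refl

  below : ∀ r i j → pos r i ≡ pos (suc r) j → i ≡ coCount (letter r) + j
  below r i j e = pos-injective r (trans e (pos-next r j))

  below⁻ : ∀ r i j → i ≡ coCount (letter r) + j → pos r i ≡ pos (suc r) j
  below⁻ r i j e = trans (cong (pos r) e) (sym (pos-next r j))

  module FromGood (g : Cell → Dir) (good : Good g) where

    up′ lo′ : ℕ → ℕ → Side
    up′ r i = sideUp (g (U r i))
    lo′ r i = sideLo (g (L r i))

    partner : ∀ {c c′ d} → c ∈ cells → g c ≡ d → neighbor c d ≡ just c′ → c′ ∈ cells × g c′ ≡ opp d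
    partner {c} c∈ refl e with good c c∈
    ... | c″ , e′ , c″∈ , q with trans (sym e) e′
    ... | refl = c″∈ , q

    impossible : ∀ {c d} → c ∈ cells → g c ≡ d → neighbor c d ≢ nothing
    impossible {c} c∈ refl e with good c c∈
    ... | c″ , e′ , _ = contradiction (trans (sym e) e′) λ ()

    S-dir : ∀ {d} → sideLo d ≡ left → d ≡ dS
    S-dir {dS} e = refl
    E-dir : ∀ {d} → sideLo d ≡ right → d ≡ dE
    E-dir {dE} e = refl
    W-dir : ∀ {d} → sideUp d ≡ left → d ≡ dW
    W-dir {dW} e = refl
    N-dir : ∀ {d} → sideUp d ≡ right → d ≡ dN
    N-dir {dN} e = refl

    below-S : ∀ r i → r ≤ N → i < height r → lo′ r i ≡ left →
      r < N × Σ ℕ λ j → j < height (suc r) × i ≡ coCount (letter r) + j × up′ (suc r) j ≡ right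
    below-S r i p q e with partner (L∈ r i p q) (S-dir e) (neighbor-S r (pos r i))
    ... | m , f with position m
    ... | r<N , j , j< , x = r<N , j , j< , below r i j x , trans (cong (λ z → sideUp (g (cell (suc r) z (upPiece (suc r))))) (sym x)) (cong sideUp f)

    below-E : ∀ r i → r ≤ N → i < height r → lo′ r i ≡ right →
      r < N × Σ ℕ λ j → j < height (suc r) × suc i ≡ coCount (letter r) + j × up′ (suc r) j ≡ left
    below-E r i p q e with partner (L∈ r i p q) (E-dir e) (neighbor-E r (pos r i))
    ... | m , f with position m
    ... | r<N , j , j< , x = r<N , j , j< , below r (suc i) j (trans (sym (pos-suc r i)) x) ,
      trans (cong (λ z → sideUp (g (cell (suc r) z (upPiece (suc r))))) (sym x)) (cong sideUp f)

    links : ∀ r → r < N → Links (letter r) (height r) (height (suc r)) (lo′ r) (up′ (suc r))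
    links r p = record
      { lo-left = λ i q e → proj₂ (below-S r i (<⇒≤ p) q e)
      ; lo-right = λ i q e → proj₂ (below-E r i (<⇒≤ p) q e)
      ; up-right = ur
      ; up-left = ul }
      where
      ur : ∀ j → j < height (suc r) → up′ (suc r) j ≡ right →
        Σ ℕ λ i → i < height r × i ≡ coCount (letter r) + j × lo′ r i ≡ left
      ur j q e with partner (U∈ (suc r) j p q) (N-dir e) (neighbor-N r (pos (suc r) j))
      ... | m , f with position m
      ... | _ , i , i< , x = i , i< , below r i j (sym x) ,
        trans (cong (λ z → sideLo (g (cell r z (loPiece r)))) (sym x)) (cong sideLo f)
      ul : ∀ j → j < height (suc r) → up′ (suc r) j ≡ left →
        Σ ℕ λ i → i < height r × suc i ≡ coCount (letter r) + j × lo′ r i ≡ right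
      ul j q e with partner (U∈ (suc r) j p q) (W-dir e) (neighbor-W r (pos (suc r) j))
      ... | m , f with position m
      ... | _ , i , i< , x = i , i< , below r (suc i) j (sym (trans (minus-plus _ _ x) (pos-suc r i))) ,
        trans (cong (λ z → sideLo (g (cell r z (loPiece r)))) (sym x)) (cong sideLo f)

    -- `isCut r` is replaced by a variable `b` with equations for the two cells, so that splitting
    -- on it affects only these cells and not `cells` itself.
    joint′ : ∀ r i b → U r i ≡ cell r (pos r i) (upOf b) → L r i ≡ cell r (pos r i) (loOf b) →
      U r i ∈ cells → L r i ∈ cells → Joint b (up′ r i) (lo′ r i)
    joint′ r i false eu el u l rewrite eu | el with g (cell r (pos r i) sq) in e
    ... | dE = refl
    ... | dW = refl
    ... | dN = refl
    ... | dS = refl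
    ... | dG = ⊥-elim (impossible u e (neighbor-edgeless r (pos r i) sq-G))
    joint′ r i true eu el u l rewrite eu | el with g (cell r (pos r i) up) in e | g (cell r (pos r i) down) in e′
    ... | dE | _ = ⊥-elim (impossible u e (neighbor-edgeless r (pos r i) up-E))
    ... | dS | _ = ⊥-elim (impossible u e (neighbor-edgeless r (pos r i) up-S))
    ... | _ | dW = ⊥-elim (impossible l e′ (neighbor-edgeless r (pos r i) down-W))
    ... | _ | dN = ⊥-elim (impossible l e′ (neighbor-edgeless r (pos r i) down-N))
    ... | dW | dE = refl
    ... | dW | dS = refl
    ... | dN | dE = refl
    ... | dN | dS = refl
    ... | dG | dG = refl
    ... | dG | dE = contradiction (trans (sym e′) (proj₂ (partner u e (neighbor-up-G r (pos r i))))) λ ()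
    ... | dG | dS = contradiction (trans (sym e′) (proj₂ (partner u e (neighbor-up-G r (pos r i))))) λ ()
    ... | dW | dG = contradiction (trans (sym e) (proj₂ (partner l e′ (neighbor-down-G r (pos r i))))) λ ()
    ... | dN | dG = contradiction (trans (sym e) (proj₂ (partner l e′ (neighbor-down-G r (pos r i))))) λ ()

    sides-valid : Valid up′ lo′
    sides-valid = record
      { top = λ i q → tp i q (up′ 0 i) refl
      ; bottom = λ i q → bt i q (lo′ N i) refl
      ; joint = λ r p i q → joint′ r i (isCut r) refl refl (U∈ r i p q) (L∈ r i p q)
      ; zig = λ r p → Links⇒ZigAt (letter r) (height-step r p) (links r p) }
      where
      tp : ∀ i → i < height 0 → ∀ s → up′ 0 i ≡ s → s ≡ none
      tp i q none e = refl
      tp i q left e = ⊥-elim (impossible (U∈ 0 i z≤n q) refl (neighbor-top (pos 0 i) _ λ n → contradiction (trans (sym e) n) λ ()))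
      tp i q right e = ⊥-elim (impossible (U∈ 0 i z≤n q) refl (neighbor-top (pos 0 i) _ λ n → contradiction (trans (sym e) n) λ ()))
      bt : ∀ i → i < height N → ∀ s → lo′ N i ≡ s → s ≡ none
      bt i q none e = refl
      bt i q left e = ⊥-elim (<-irrefl refl (proj₁ (below-S N i ≤-refl q e)))
      bt i q right e = ⊥-elim (<-irrefl refl (proj₁ (below-E N i ≤-refl q e)))

    private
      dirAt-sq : ∀ d → d ≢ dG → dirAt sq (sideUp d) (sideLo d) ≡ d
      dirAt-sq dE _ = refl
      dirAt-sq dW _ = refl
      dirAt-sq dN _ = refl
      dirAt-sq dS _ = refl
      dirAt-sq dG n = ⊥-elim (n refl)

      dirAt-U : ∀ r i b → U r i ≡ cell r (pos r i) (upOf b) → L r i ≡ cell r (pos r i) (loOf b) → U r i ∈ cells →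
        dirAt (upOf b) (up′ r i) (lo′ r i) ≡ g (U r i)
      dirAt-U r i false eu el u rewrite eu | el =
        dirAt-sq _ λ e → impossible u e (neighbor-edgeless r (pos r i) sq-G)
      dirAt-U r i true eu el u rewrite eu with g (cell r (pos r i) up) in e
      ... | dE = ⊥-elim (impossible u e (neighbor-edgeless r (pos r i) up-E))
      ... | dS = ⊥-elim (impossible u e (neighbor-edgeless r (pos r i) up-S))
      ... | dW = refl
      ... | dN = refl
      ... | dG = refl

      dirAt-L : ∀ r i b → U r i ≡ cell r (pos r i) (upOf b) → L r i ≡ cell r (pos r i) (loOf b) → L r i ∈ cells →
        dirAt (loOf b) (up′ r i) (lo′ r i) ≡ g (L r i)
      dirAt-L r i false eu el l rewrite eu | el =
        dirAt-sq _ λ e → impossible l e (neighbor-edgeless r (pos r i) sq-G)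
      dirAt-L r i true eu el l rewrite el with g (cell r (pos r i) down) in e
      ... | dW = ⊥-elim (impossible l e (neighbor-edgeless r (pos r i) down-W))
      ... | dN = ⊥-elim (impossible l e (neighbor-edgeless r (pos r i) down-N))
      ... | dE = refl
      ... | dS = refl
      ... | dG = refl

    rebuild-U : ∀ r i → r ≤ N → i < height r → dirAt (upPiece r) (up′ r i) (lo′ r i) ≡ g (U r i)
    rebuild-U r i p q = dirAt-U r i (isCut r) refl refl (U∈ r i p q)

    rebuild-L : ∀ r i → r ≤ N → i < height r → dirAt (loPiece r) (up′ r i) (lo′ r i) ≡ g (L r i)
    rebuild-L r i p q = dirAt-L r i (isCut r) refl refl (L∈ r i p q)

  dirOf : (ups los : ℕ → ℕ → Side) → Cell → Dir
  dirOf ups los (cell r x p) = dirAt p (ups r ∣ x - xQ r ∣) (los r ∣ x - xQ r ∣)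

  dirOf-pos : ∀ ups los r i p → dirOf ups los (cell r (pos r i) p) ≡ dirAt p (ups r i) (los r i)
  dirOf-pos ups los r i p = cong (λ k → dirAt p (ups r k) (los r k)) (index r i)

  module FromValid (ups los : ℕ → ℕ → Side) (v : Valid ups los) where

    g : Cell → Dir
    g = dirOf ups los

    g-L : ∀ r i → r ≤ N → i < height r → ∀ s → los r i ≡ s → s ≢ none → g (L r i) ≡ dirLo s
    g-L r i p q _ refl n = trans (dirOf-pos ups los r i (loPiece r)) (dirAt-lo (isCut r) _ _ (joint v r p i q) n)

    g-U : ∀ r i s → ups r i ≡ s → s ≢ none → g (U r i) ≡ dirUp s
    g-U r i _ refl n = trans (dirOf-pos ups los r i (upPiece r)) (dirAt-up (isCut r) _ _ n)

    sideLo-g : ∀ r i → r ≤ N → i < height r → sideLo (g (L r i)) ≡ los r i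
    sideLo-g r i p q = trans (cong sideLo (dirOf-pos ups los r i (loPiece r))) (sideLo-dirAt (isCut r) _ _ (joint v r p i q))

    Partner : Cell → Set
    Partner c = Σ Cell λ c′ → neighbor c (g c) ≡ just c′ × c′ ∈ cells × g c′ ≡ opp (g c)

    pair : ∀ {c c′ d} → g c ≡ d → neighbor c d ≡ just c′ → c′ ∈ cells → g c′ ≡ opp d → Partner c
    pair {c} {c′} refl e m q = c′ , e , m , q

    linked : ∀ r → r < N → Links (letter r) (height r) (height (suc r)) (los r) (ups (suc r))
    linked r p = ZigAt⇒Links (letter r) (height-step r p) (zig v r p)

    not-last : ∀ r i → r ≤ N → i < height r → los r i ≢ none → r < N
    not-last r i p q n with m≤n⇒m<n∨m≡n p
    ... | inj₁ r<N = r<N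
    ... | inj₂ refl = ⊥-elim (n (bottom v i q))

    partner-L : ∀ r i → r ≤ N → i < height r → los r i ≢ none → Partner (L r i)
    partner-L r i p q n = go (los r i) refl
      where
      r<N = not-last r i p q n
      go : ∀ s → los r i ≡ s → Partner (L r i)
      go none e = ⊥-elim (n e)
      go left e with lo-left (linked r r<N) i q e
      ... | j , j< , x , f with below⁻ r i j x
      ... | y = pair (g-L r i p q left e λ ()) (trans (neighbor-S r (pos r i)) (cong (λ z → just (cell (suc r) z (upPiece (suc r)))) y))
        (U∈ (suc r) j r<N j<) (g-U (suc r) j right f λ ())
      go right e with lo-right (linked r r<N) i q e
      ... | j , j< , x , f with below⁻ r (suc i) j x
      ... | y = pair (g-L r i p q right e λ ())
        (trans (neighbor-E r (pos r i)) (cong (λ z → just (cell (suc r) z (upPiece (suc r)))) (trans (pos-suc r i) y)))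
        (U∈ (suc r) j r<N j<) (g-U (suc r) j left f λ ())

    partner-U : ∀ r i → r ≤ N → i < height r → ups r i ≢ none → Partner (U r i)
    partner-U zero i p q n = ⊥-elim (n (top v i q))
    partner-U (suc r) j p q n = go (ups (suc r) j) refl
      where
      go : ∀ s → ups (suc r) j ≡ s → Partner (U (suc r) j)
      go none e = ⊥-elim (n e)
      go right e with up-right (linked r p) j q e
      ... | i , i< , x , f with below⁻ r i j x
      ... | y = pair (g-U (suc r) j right e λ ()) (trans (neighbor-N r (pos (suc r) j)) (cong (λ z → just (cell r z (loPiece r))) (sym y)))
        (L∈ r i (<⇒≤ p) i<) (g-L r i (<⇒≤ p) i< left f λ ())
      go left e with up-left (linked r p) j q e
      ... | i , i< , x , f with below⁻ r (suc i) j x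
      ... | y = pair (g-U (suc r) j left e λ ())
        (trans (neighbor-W r (pos (suc r) j)) (cong (λ z → just (cell r z (loPiece r))) (plus-minus _ _ (trans (sym y) (sym (pos-suc r i))))))
        (L∈ r i (<⇒≤ p) i<) (g-L r i (<⇒≤ p) i< right f λ ())

    covered-cases : ∀ s → s ≡ none ⊎ s ≢ none
    covered-cases none = inj₁ refl
    covered-cases left = inj₂ λ ()
    covered-cases right = inj₂ λ ()

    partners : ∀ r i b → U r i ≡ cell r (pos r i) (upOf b) → L r i ≡ cell r (pos r i) (loOf b) → r ≤ N → i < height r →
      Joint b (ups r i) (los r i) → Partner (U r i) × Partner (L r i)
    partners r i b eu el p q j with covered-cases (ups r i) | covered-cases (los r i)
    partners r i true eu el p q j | inj₂ u | inj₂ l = partner-U r i p q u , partner-L r i p q l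
    partners r i true eu el p q j | inj₁ u | inj₁ l =
      subst Partner (sym eu) (pair gu (neighbor-up-G r (pos r i)) (subst (_∈ cells) el (L∈ r i p q)) gl) ,
      subst Partner (sym el) (pair gl (neighbor-down-G r (pos r i)) (subst (_∈ cells) eu (U∈ r i p q)) gu)
      where
      gu : g (cell r (pos r i) up) ≡ dG
      gu = trans (dirOf-pos ups los r i up) (cong dirUp u)
      gl : g (cell r (pos r i) down) ≡ dG
      gl = trans (dirOf-pos ups los r i down) (cong dirLo l)
    partners r i true eu el p q j | inj₁ u | inj₂ l = ⊥-elim (l (uncovered (trans (sym j) (cong covered u))))
    partners r i true eu el p q j | inj₂ u | inj₁ l = ⊥-elim (u (uncovered (trans j (cong covered l))))
    partners r i false eu el p q j | inj₁ u | inj₁ l =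
      contradiction (trans (sym (cong covered u)) (trans j (cong (λ s → not (covered s)) l))) λ ()
    -- In an uncut row `U r i` and `L r i` are the same square, so the partner found on one side
    -- serves both.
    partners r i false eu el p q j | inj₂ u | _ = partner-U r i p q u , subst Partner (trans eu (sym el)) (partner-U r i p q u)
    partners r i false eu el p q j | inj₁ _ | inj₂ l = subst Partner (trans el (sym eu)) (partner-L r i p q l) , partner-L r i p q l

    g-good : Good g
    g-good c c∈ with ∈-cells⁻ c∈
    ... | upper-cell r i p q = proj₁ (partners r i (isCut r) refl refl p q (joint v r p i q))
    ... | lower-cell r i p q = proj₂ (partners r i (isCut r) refl refl p q (joint v r p i q))

  pathsOf : ∀ g → Good g → Paths
  pathsOf g good = toPaths (FromGood.sides-valid g good)

  dirOf-pathsOf : ∀ g (good : Good g) {c} → InRegion c →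
    dirOf (upper (pathsOf g good)) (lower (pathsOf g good)) c ≡ g c
  dirOf-pathsOf g good = agree
    where
    open FromGood g good
    sides : ∀ r i p → r ≤ N → i < height r →
      dirOf (upper (pathsOf g good)) (lower (pathsOf g good)) (cell r (pos r i) p) ≡ dirAt p (up′ r i) (lo′ r i)
    sides r i p r≤ i< = trans (dirOf-pos (upper (pathsOf g good)) (lower (pathsOf g good)) r i p)
      (cong₂ (dirAt p) (upper-toPaths sides-valid r r≤ i i<) (lower-toPaths sides-valid r r≤ i i<))
    agree : ∀ {c} → InRegion c → dirOf (upper (pathsOf g good)) (lower (pathsOf g good)) c ≡ g c
    agree (upper-cell r i p q) = trans (sides r i (upPiece r) p q) (rebuild-U r i p q)
    agree (lower-cell r i p q) = trans (sides r i (loPiece r) p q) (rebuild-L r i p q)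

  pathsOf-unique : ∀ g (good : Good g) c →
    (∀ r → r ≤ N → ∀ i → i < height r → g (L r i) ≡ dirOf (upper c) (lower c) (L r i)) → pathsOf g good ≡ c
  pathsOf-unique g good c e = toPaths-unique (FromGood.sides-valid g good) c λ r p i q →
    trans (cong sideLo (e r p i q)) (FromValid.sideLo-g (upper c) (lower c) (valid c) r i p q)

  Tiling-ext : ∀ {s t : Tiling} → proj₁ s ≡ proj₁ t → s ≡ t
  Tiling-ext {v , _} refl = cong (v ,_) (T-irrelevant _ _)

  Tiling↔Paths : Tiling ↔ Paths
  Tiling↔Paths = mk↔ₛ′ to from to∘from from∘to
    where
    to : Tiling → Paths
    to (v , t) = pathsOf (direction v) (tiling⇒good v t)

    from : Paths → Tiling
    from c = record-directions (dirOf (upper c) (lower c)) ,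
      good⇒tiling _ (FromValid.g-good (upper c) (lower c) (valid c))

    to∘from : ∀ c → to (from c) ≡ c
    to∘from c = pathsOf-unique _ _ c λ r p i q → direction-record (dirOf (upper c) (lower c)) (L r i) (L∈ r i p q)

    from∘to : ∀ s → from (to s) ≡ s
    from∘to (v , t) = Tiling-ext (record-direction _ v λ c c∈ → dirOf-pathsOf (direction v) (tiling⇒good v t) (∈-cells⁻ c∈))

theorem1p3 : (a : ℕ) (ds : List ℕ) →
    1 ≤ a → 1 ≤ length ds → All (1 ≤_) ds →
    (∀ x → Region.color a ds (cell (Region.N a ds) x sq) ≡ white) →
    (∀ d → d ≤ Region.N a ds → Region.P a ds d ≢ Region.Q a ds d) →
    proj₂ (Region.D a ds) ≡ proj₂ (Region.B a ds) →
    triangular (Region.width a ds) ≤ Region.nRegular a ds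
    × (Region.Tiling a ds ↔ Fin (2 ^ (Region.nRegular a ds ∸ triangular (Region.width a ds))))
theorem1p3 a ds _ _ pos-ds wh _ balance =
  -- This inequality makes the truncated subtraction in the exponent exact.
  subst (triangular width ≤_) (sym nRegular-formula) (m≤m+n (triangular width) inv) ,
  ↔-trans (Bridge.Tiling↔Paths a ds pos-ds wh balance)
    -- `Chain-count` starts from a row of length `#co w`; `Y-last` identifies this with `a`, the
    -- length of the top row.
    (subst₂ (λ n k → Chain w (replicate n false) ↔ Fin (2 ^ k)) Y-last exponent (Chain-count w 0))
  where
  open Region a ds using (N; width; nRegular)
  open Geometry a ds pos-ds using (letter; module Balanced)
  open Balanced balance using (Y-last; nRegular-formula)
  w = word letter N
  inv = inversions 0 w
  exponent : inv ≡ nRegular ∸ triangular width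
  exponent = sym (trans (cong (_∸ triangular width) nRegular-formula) (m+n∸m≡n (triangular width) inv))
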